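{- Let $P\subset\mathbb{R}^n$ be a rational polytope of dimension $n$ containing the origin, such that its dual $P^\vee=\{u\in\mathbb{R}^n\mid \langle u,v\rangle\le 1\text{ for all }v\in P\}$ is a lattice polytope (i.e. a polytope with all vertices in $\mathbb{Z}^n$). Let $k$ be the smallest positive integer such that $kP$ is a lattice polytope. For each $r\in\{0,1,\dots,k-1\}$ let $L_{P,r}$ be the polynomial in $l$ of degree $n$ with $L_{P,r}(l)=|(lk+r)P\cap\mathbb{Z}^n|$ for all integers $l\ge 0$, and define integers $\delta_{0,r},\dots,\delta_{n,r}$ by $$\sum_{l\ge 0}L_{P,r}(l)t^l=\frac{\delta_{0,r}+\delta_{1,r}t+\dots+\delta_{n,r}t^n}{(1-t)^{n+1}}.$$ Then $\delta_{i,r}=\delta_{n-i,k-r-1}$ for all $0\le i\le n$ and $0\le r\le k-1$.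
   Context: A rational polytope is the convex hull of finitely many points of $\mathbb{Q}^n$. For a rational polytope $P$ and $m\in\mathbb{Z}_{\ge0}$, the number $L_P(m)=|mP\cap\mathbb{Z}^n|$ of lattice points in the dilate $mP$ is a quasi-polynomial in $m$ whose period divides $k$, so that for each residue $r$ the function $l\mapsto L_P(lk+r)$ agrees with a polynomial $L_{P,r}$ of degree $n$. -}

module Defs where

open import Data.Nat as ℕ using (ℕ; zero; suc; _∸_; _<_)
open import Data.Integer as ℤ using (ℤ; +_; -[1+_])
open import Data.Rational as ℚ using (ℚ; 0ℚ; 1ℚ; _≤_)
open import Data.Vec using (Vec; []; _∷_; map; zipWith; replicate)
open import Data.Vec.Relation.Unary.All using (All)
open import Data.List using (List; length)
open import Data.List.Membership.Propositional using (_∈_)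
open import Data.List.Relation.Unary.Unique.Propositional using (Unique)
open import Data.Product using (Σ; _×_)
open import Data.Bool using (if_then_else_)
open import Relation.Binary.PropositionalEquality using (_≡_)
open import Relation.Nullary using (¬_)

Point : ℕ → Set
Point n = Vec ℚ n

IntPoint : ℕ → Set
IntPoint n = Vec ℤ n

toℚ : ℤ → ℚ
toℚ z = z ℚ./ 1

intPt : ∀ {n} → IntPoint n → Point n
intPt = map toℚ

origin : ∀ {n} → Point n
origin = replicate _ 0ℚ

_+ᵥ_ : ∀ {n} → Point n → Point n → Point n
_+ᵥ_ = zipWith ℚ._+_

_·ᵥ_ : ∀ {n} → ℚ → Point n → Point n
c ·ᵥ v = map (c ℚ.*_) v

⟨_,_⟩ : ∀ {n} → Point n → Point n → ℚ
⟨ [] , [] ⟩ = 0ℚ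
⟨ x ∷ xs , y ∷ ys ⟩ = x ℚ.* y ℚ.+ ⟨ xs , ys ⟩

sumℚ : ∀ {m} → Vec ℚ m → ℚ
sumℚ [] = 0ℚ
sumℚ (c ∷ cs) = c ℚ.+ sumℚ cs

comb : ∀ {n m} → Vec ℚ m → Vec (Point n) m → Point n
comb [] [] = origin
comb (c ∷ cs) (v ∷ vs) = (c ·ᵥ v) +ᵥ comb cs vs

InConv : ∀ {n m} → Vec (Point n) m → Point n → Set
InConv {n} {m} vs x =
  Σ (Vec ℚ m) λ cs → All (0ℚ ≤_) cs × sumℚ cs ≡ 1ℚ × comb cs vs ≡ x

InAff : ∀ {n m} → Vec (Point n) m → Point n → Set
InAff {n} {m} vs x = Σ (Vec ℚ m) λ cs → sumℚ cs ≡ 1ℚ × comb cs vs ≡ x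

FullDim : ∀ {n m} → Vec (Point n) m → Set
FullDim {n} vs = (x : Point n) → InAff vs x

-- the dilate j·conv(vs) = conv(j·vs)
dilate : ∀ {n m} → ℕ → Vec (Point n) m → Vec (Point n) m
dilate j vs = map ((+ j ℚ./ 1) ·ᵥ_) vs

IsLatticePolytopeSet : ∀ {n} → (Point n → Set) → Set
IsLatticePolytopeSet {n} S =
  Σ ℕ λ p → Σ (Vec (IntPoint n) p) λ ws →
    ((x : Point n) → S x → InConv (map intPt ws) x) ×
    ((x : Point n) → InConv (map intPt ws) x → S x)

IsLatticePolytope : ∀ {n m} → Vec (Point n) m → Set
IsLatticePolytope vs = IsLatticePolytopeSet (InConv vs)

InDual : ∀ {n m} → Vec (Point n) m → Point n → Set
InDual {n} vs u = (v : Point n) → InConv vs v → ⟨ u , v ⟩ ≤ 1ℚ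

IsMinDenominator : ∀ {n m} → Vec (Point n) m → ℕ → Set
IsMinDenominator vs k =
  0 < k × IsLatticePolytope (dilate k vs) ×
  ((j : ℕ) → 0 < j → j < k → ¬ IsLatticePolytope (dilate j vs))

LatticeCount : ∀ {n m} → Vec (Point n) m → ℕ → Set
LatticeCount {n} vs N =
  Σ (List (IntPoint n)) λ zs → length zs ≡ N × Unique zs ×
    ((z : IntPoint n) → z ∈ zs → InConv vs (intPt z)) ×
    ((z : IntPoint n) → InConv vs (intPt z) → z ∈ zs)

IsEhrhart : ∀ {n m} → Vec (Point n) m → (ℕ → ℕ) → Set
IsEhrhart vs c = (j : ℕ) → LatticeCount (dilate j vs) (c j)

-- formal power series over ℤ, as coefficient sequences
PS : Set
PS = ℕ → ℤ

sumTo : ℕ → (ℕ → ℤ) → ℤ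
sumTo zero f = f 0
sumTo (suc m) f = sumTo m f ℤ.+ f (suc m)

_⊛_ : PS → PS → PS
(f ⊛ g) m = sumTo m (λ j → f j ℤ.* g (m ∸ j))

onePS : PS
onePS zero = + 1
onePS (suc _) = + 0

oneMinusT : PS
oneMinusT zero = + 1
oneMinusT (suc zero) = -[1+ 0 ]
oneMinusT (suc (suc _)) = + 0

powPS : PS → ℕ → PS
powPS f zero = onePS
powPS f (suc e) = f ⊛ powPS f e

truncPS : ℕ → (ℕ → ℤ) → PS
truncPS n δ i = if i ℕ.≤ᵇ n then δ i else + 0

-- Σ_{l≥0} c(lk+r) tˡ = (δ 0 + ... + δ n tⁿ)/(1-t)^{n+1},
-- i.e. (1-t)^{n+1} · Σ_{l≥0} c(lk+r) tˡ = δ 0 + ... + δ n tⁿ in ℤ[[t]]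
IsHStar : (n k : ℕ) (c : ℕ → ℕ) (r : ℕ) (δ : ℕ → ℤ) → Set
IsHStar n k c r δ =
  (i : ℕ) → (powPS oneMinusT (suc n) ⊛ (λ l → + c (l ℕ.* k ℕ.+ r))) i ≡ truncPS n δ i

{-# OPTIONS --safe #-}
module Submission where

-- Let U be the integral generators of the dual. By Farkas, a lattice point x lies in mP iff
-- u · x ≤ m for all u ∈ U, so the lattice points of the dilates are those of the cone
-- C = {ℓᵤ ≥ 0} ⊂ ℤ^{n+1}, ℓᵤ(m , x) = m - u · x, and since the ℓᵤ are integral, ℓᵤ(m , x) < 0 iff
-- ℓᵤ(-1 - m , -x) ≥ 0. With hᵤ the indicator of ℓᵤ ≥ 0 and d = n + 1, reciprocity for C is the
-- claim that Π hᵤ - (-1)^d Π (1 - hᵤ) is torsion: annihilated by a product of difference operators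
-- f ↦ f(· + w) - f with w ≠ 0. This needs no triangulation. It is proved for all products of
-- literals hᵤ, 1 - hᵤ by induction on the number of factors:
--   * fewer than d functionals have a common kernel vector, along which both products are invariant;
--   * for exactly d, Π hᵤ - Π (hᵤ - 1) telescopes into products of d - 1 factors;
--   * more than d satisfy a relation Σ λᵤ ℓᵤ = 0, in which both signs occur because all ℓᵤ are
--     positive at (1 , 0). Choosing the literals according to the signs of λ makes both products
--     vanish, and changing a literal into its negation costs only a shorter product.
-- Since C has finite fibres over m, horizontal directions w can be cancelled, and summing over the
-- fibres shows that the sequence equal to L(lk + r) for l ≥ 0 and (-1)^n L(-lk - r - 1) for l < 0
-- is torsion on ℤ. For large l it satisfies the recurrence (1 - T)^{n+1}, hence it does so for
-- all l, and reading the recurrence at 0 ≤ l ≤ n compares the two numerators.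

open import Defs
open import Data.Nat using (ℕ; _≤_; _<_; _∸_)
open import Data.Integer using (ℤ)
open import Data.Vec using (Vec)
open import Relation.Binary.PropositionalEquality using (_≡_)

open import Data.Bool as Bool using (Bool; true; false; not; T)
open import Data.Bool.Properties using (¬-not)
open import Data.Empty using (⊥-elim)
open import Data.Integer as ℤ using (+_; -[1+_]; 0ℤ; 1ℤ; -1ℤ)
import Data.Integer.Properties as ℤₚ
open import Data.Integer.Tactic.RingSolver using (solve-∀)
open import Data.List as List using (List; []; _∷_; _++_; _ʳ++_; filter; deduplicate; length)
open import Data.List.Membership.Propositional using (_∈_)
open import Data.List.Membership.Propositional.Properties
  using (∈-map⁺; ∈-++⁺ˡ; ∈-++⁺ʳ; ∈-filter⁺; ∈-filter⁻; ∈-deduplicate⁺)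
open import Data.List.Membership.Propositional.Properties.WithK using (unique∧set⇒bag)
import Data.List.Properties as Listₚ
open import Data.List.Properties using (length-map; length-ʳ++; map-ʳ++)
open import Data.List.Relation.Binary.BagAndSetEquality using (∼bag⇒↭)
open import Data.List.Relation.Binary.Permutation.Propositional as Perm using (_↭_)
import Data.List.Relation.Unary.All as ListAll
import Data.List.Relation.Unary.All.Properties as ListAllₚ
import Data.List.Relation.Unary.AllPairs as AllPairs
open import Data.List.Relation.Unary.Any using (here; there)
open import Data.List.Relation.Unary.Unique.DecPropositional.Properties using (deduplicate-!)
open import Data.List.Relation.Unary.Unique.Propositional using (Unique)
import Data.List.Relation.Unary.Unique.Propositional.Properties as Uniqueₚ
open import Data.Nat as ℕ using (zero; suc; z≤n; s≤s)
import Data.Nat.Properties as ℕₚ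
open import Data.Product using (Σ; ∃-syntax; _×_; _,_; proj₁; proj₂; map₁)
open import Data.Rational as ℚ using (ℚ; 0ℚ; 1ℚ)
import Data.Rational.Properties as ℚₚ
open import Data.Rational.Solver using (module +-*-Solver)
open import Data.Rational.Unnormalised as ℚᵘ using (mkℚᵘ; *≡*; *≤*)
import Data.Rational.Unnormalised.Properties as ℚᵘₚ
open import Data.Sum using (_⊎_; inj₁; inj₂)
open import Data.Vec as Vec using ([]; _∷_; map; zipWith; replicate; transpose)
open import Data.Vec.Properties
  using (∷-injective; ≡-dec; toList∘fromList; zipWith-assoc; zipWith-comm; zipWith-identityʳ; zipWith-inverseʳ)
open import Data.Vec.Relation.Unary.All as All using (All; []; _∷_)
import Data.Vec.Relation.Unary.All.Properties as Allₚ
open import Data.Vec.Relation.Unary.Any using (Any; here; there)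
open import Function using (_∘_; _$_)
open import Function.Bundles using (mk⇔)
open import Relation.Binary.Definitions using (DecidableEquality; tri<; tri≈; tri>)
open import Relation.Binary.PropositionalEquality
  using (_≢_; refl; sym; trans; cong; cong₂; subst; subst₂; module ≡-Reasoning)
open import Relation.Nullary using (¬_; Dec; yes; no; ¬?)

open +-*-Solver using (solve; _:+_; _:*_; _:-_; :-_; _:=_; con)

-- Integer linear algebra

infixl 6 _⊕_
infixl 7 _∙_
infixr 7 _⊡_

_⊕_ : ∀ {d} → Vec ℤ d → Vec ℤ d → Vec ℤ d
_⊕_ = zipWith ℤ._+_

_∙_ : ∀ {d} → Vec ℤ d → Vec ℤ d → ℤ
[] ∙ [] = 0ℤ
(x ∷ xs) ∙ (y ∷ ys) = x ℤ.* y ℤ.+ xs ∙ ys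

_⊡_ : ∀ {d} → ℤ → Vec ℤ d → Vec ℤ d
k ⊡ x = map (k ℤ.*_) x

0ᵥ : ∀ {d} → Vec ℤ d
0ᵥ = replicate _ 0ℤ

∙-⊕ : ∀ {d} (a x y : Vec ℤ d) → a ∙ (x ⊕ y) ≡ a ∙ x ℤ.+ a ∙ y
∙-⊕ [] [] [] = refl
∙-⊕ (a ∷ as) (x ∷ xs) (y ∷ ys) rewrite ∙-⊕ as xs ys =
  lemma a x y (as ∙ xs) (as ∙ ys)
  where
  lemma : ∀ a x y p q → a ℤ.* (x ℤ.+ y) ℤ.+ (p ℤ.+ q) ≡ (a ℤ.* x ℤ.+ p) ℤ.+ (a ℤ.* y ℤ.+ q)
  lemma = solve-∀

∙-⊡ : ∀ {d} (a : Vec ℤ d) k x → a ∙ (k ⊡ x) ≡ k ℤ.* (a ∙ x)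
∙-⊡ [] k [] = sym (ℤₚ.*-zeroʳ k)
∙-⊡ (a ∷ as) k (x ∷ xs) rewrite ∙-⊡ as k xs = lemma a k x (as ∙ xs)
  where
  lemma : ∀ a k x p → a ℤ.* (k ℤ.* x) ℤ.+ k ℤ.* p ≡ k ℤ.* (a ℤ.* x ℤ.+ p)
  lemma = solve-∀

∙-comm : ∀ {d} (x y : Vec ℤ d) → x ∙ y ≡ y ∙ x
∙-comm [] [] = refl
∙-comm (x ∷ xs) (y ∷ ys) = cong₂ ℤ._+_ (ℤₚ.*-comm x y) (∙-comm xs ys)

∙-zeroˡ : ∀ {d} (y : Vec ℤ d) → 0ᵥ ∙ y ≡ 0ℤ
∙-zeroˡ [] = refl
∙-zeroˡ (y ∷ ys) rewrite ∙-zeroˡ ys = refl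

∙-zeroʳ : ∀ {d} (y : Vec ℤ d) → y ∙ 0ᵥ ≡ 0ℤ
∙-zeroʳ y = trans (∙-comm y 0ᵥ) (∙-zeroˡ y)

⊡≡0 : ∀ {d} k (x : Vec ℤ d) → k ≢ 0ℤ → k ⊡ x ≡ 0ᵥ → x ≡ 0ᵥ
⊡≡0 k [] k≢0 eq = refl
⊡≡0 k (x ∷ xs) k≢0 eq with ∷-injective eq
... | p , q with ℤₚ.i*j≡0⇒i≡0∨j≡0 k p
... | inj₁ k≡0 = ⊥-elim (k≢0 k≡0)
... | inj₂ refl = cong (0ℤ ∷_) (⊡≡0 k xs k≢0 q)

-- No division is used: for a nonzero first entry `g`, y is sent to (-(gs · y), g y); a zero entry
-- leaves its coordinate free and passes to the tail, until the domain is trivial. The transpose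
-- `φᵀ` pulls functionals back along `φ`.
hyperplane : ∀ {e} (g : Vec ℤ (suc e)) →
  Σ (Vec ℤ e → Vec ℤ (suc e)) λ φ → Σ (Vec ℤ (suc e) → Vec ℤ e) λ φᵀ →
    (∀ y → g ∙ φ y ≡ 0ℤ) × (∀ y → φ y ≡ 0ᵥ → y ≡ 0ᵥ) × (∀ a y → a ∙ φ y ≡ φᵀ a ∙ y)
hyperplane (g ∷ gs) with g ℤ.≟ 0ℤ
hyperplane {e} (g ∷ gs) | no g≢0 = φ , φᵀ , kernel , inj , adjoint
  where
  φ : Vec ℤ e → Vec ℤ (suc e)
  φ y = ℤ.- (gs ∙ y) ∷ g ⊡ y
  φᵀ : Vec ℤ (suc e) → Vec ℤ e
  φᵀ (a ∷ as) = (g ⊡ as) ⊕ (ℤ.- a ⊡ gs)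
  kernel : ∀ y → (g ∷ gs) ∙ φ y ≡ 0ℤ
  kernel y rewrite ∙-⊡ gs g y = lemma g (gs ∙ y)
    where
    lemma : ∀ g p → g ℤ.* ℤ.- p ℤ.+ g ℤ.* p ≡ 0ℤ
    lemma = solve-∀
  inj : ∀ y → φ y ≡ 0ᵥ → y ≡ 0ᵥ
  inj y eq = ⊡≡0 g y g≢0 (proj₂ (∷-injective eq))
  adjoint : ∀ a y → a ∙ φ y ≡ φᵀ a ∙ y
  adjoint (a ∷ as) y
    rewrite ∙-comm ((g ⊡ as) ⊕ (ℤ.- a ⊡ gs)) y | ∙-⊕ y (g ⊡ as) (ℤ.- a ⊡ gs)
          | ∙-⊡ y g as | ∙-⊡ y (ℤ.- a) gs | ∙-⊡ as g y | ∙-comm y as | ∙-comm y gs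
    = lemma a g (gs ∙ y) (as ∙ y)
    where
    lemma : ∀ a g p q → a ℤ.* ℤ.- p ℤ.+ g ℤ.* q ≡ g ℤ.* q ℤ.+ ℤ.- a ℤ.* p
    lemma = solve-∀
hyperplane {zero} (_ ∷ []) | yes refl =
  (λ _ → 0ᵥ) , (λ _ → []) , (λ { [] → refl }) , (λ { [] _ → refl }) , λ { a [] → ∙-zeroʳ a }
hyperplane {suc e} (_ ∷ gs) | yes refl with hyperplane gs
... | φ , φᵀ , kernel , inj , adjoint =
    (λ { (y ∷ ys) → y ∷ φ ys })
  , (λ { (a ∷ as) → a ∷ φᵀ as })
  , (λ { (y ∷ ys) → trans (ℤₚ.+-identityˡ _) (kernel ys) })
  , (λ { (y ∷ ys) eq → cong₂ _∷_ (proj₁ (∷-injective eq)) (inj ys (proj₂ (∷-injective eq))) })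
  , (λ { (a ∷ as) (y ∷ ys) → cong (λ p → a ℤ.* y ℤ.+ p) (adjoint as ys) })

-- Elimination over ℤ: solutions of the first row are parametrised with one variable fewer, and
-- pulling the other rows back along `φ` lowers dimension and number of rows together.
commonKernel : ∀ {s d} → s ℕ.< d → (rows : Vec (Vec ℤ d) s) →
  ∃[ w ] w ≢ 0ᵥ × All (λ a → a ∙ w ≡ 0ℤ) rows
commonKernel {d = suc d} _ [] = 1ℤ ∷ 0ᵥ , (λ ()) , []
commonKernel {d = suc d} (s≤s s<d) (r ∷ rows)
  with hyperplane r
... | φ , φᵀ , kernel , inj , adjoint
  with commonKernel s<d (map φᵀ rows)
... | w , w≢0 , zs = φ w , w≢0 ∘ inj w , kernel w ∷ pullback rows zs
  where
  pullback : ∀ {s} (rows : Vec _ s) → All (λ a → a ∙ w ≡ 0ℤ) (map φᵀ rows) →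
             All (λ a → a ∙ φ w ≡ 0ℤ) rows
  pullback [] [] = []
  pullback (a ∷ as) (z ∷ zs) = trans (adjoint a w) z ∷ pullback as zs

pairing : ∀ {d s} → Vec ℤ s → Vec (Vec ℤ d) s → Vec ℤ d → ℤ
pairing λs as z = λs ∙ map (_∙ z) as

pairing-transpose : ∀ {d s} (as : Vec (Vec ℤ d) s) λs z →
  pairing λs as z ≡ map (_∙ λs) (transpose as) ∙ z
pairing-transpose {d} [] [] z = sym (trans (cong (_∙ z) (zeros d)) (∙-zeroˡ z))
  where
  zeros : ∀ d → map (_∙ []) (replicate d []) ≡ 0ᵥ
  zeros zero = refl
  zeros (suc d) = cong (0ℤ ∷_) (zeros d)
pairing-transpose (a ∷ as) (l ∷ λs) z rewrite pairing-transpose as λs z =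
  columns a (transpose as) z
  where
  columns : ∀ {d} (a : Vec ℤ d) (T : Vec (Vec ℤ _) d) z →
    l ℤ.* (a ∙ z) ℤ.+ map (_∙ λs) T ∙ z ≡ map (_∙ (l ∷ λs)) (replicate d _∷_ Vec.⊛ a Vec.⊛ T) ∙ z
  columns [] [] [] = trans (ℤₚ.+-identityʳ _) (ℤₚ.*-zeroʳ l)
  columns (x ∷ a) (t ∷ T) (y ∷ z) rewrite sym (columns a T z) =
    lem l x y (a ∙ z) (t ∙ λs) (map (_∙ λs) T ∙ z)
    where
    lem : ∀ l x y p q r → l ℤ.* (x ℤ.* y ℤ.+ p) ℤ.+ (q ℤ.* y ℤ.+ r) ≡ (x ℤ.* l ℤ.+ q) ℤ.* y ℤ.+ (l ℤ.* p ℤ.+ r)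
    lem = solve-∀

-- A relation among s functionals is a common kernel vector of the d columns of their matrix, and d
-- < s.
dependence : ∀ {s d} → d ℕ.< s → (as : Vec (Vec ℤ d) s) →
  ∃[ λs ] λs ≢ 0ᵥ × (∀ z → pairing λs as z ≡ 0ℤ)
dependence d<s as with commonKernel d<s (transpose as)
... | λs , λs≢0 , zs = λs , λs≢0 , λ z →
  trans (pairing-transpose as λs z) (trans (cong (_∙ z) (vanish zs)) (∙-zeroˡ z))
  where
  vanish : ∀ {m} {rows : Vec _ m} → All (λ a → a ∙ λs ≡ 0ℤ) rows → map (_∙ λs) rows ≡ 0ᵥ
  vanish [] = refl
  vanish (p ∷ ps) = cong₂ _∷_ p (vanish ps)

-- Torsion functions and products of literals

module _ {X W : Set} (_◂_ : X → W → X) where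

  difference : W → (X → ℤ) → X → ℤ
  difference w f x = f (x ◂ w) ℤ.- f x

  -- A certificate that a product of difference operators kills `f`: each `along` applies one more
  -- operator. The predicate `D` records which directions are admissible.
  data Torsion (D : W → Set) (f : X → ℤ) : Set where
    vanish : (∀ x → f x ≡ 0ℤ) → Torsion D f
    along  : ∀ w → D w → Torsion D (difference w f) → Torsion D f

module _ {X W : Set} {_◂_ : X → W → X} {D : W → Set} where

  -- Taking `h` up to pointwise equality avoids function extensionality; the directions of the
  -- certificate stay the same.
  torsion-scale : ∀ b {g h} → Torsion _◂_ D g → (∀ x → h x ≡ b ℤ.* g x) → Torsion _◂_ D h
  torsion-scale b (vanish z) eq =
    vanish λ x → trans (eq x) (trans (cong (b ℤ.*_) (z x)) (ℤₚ.*-zeroʳ b))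
  torsion-scale b {g} (along w Dw t) eq = along w Dw $ torsion-scale b t λ x →
    trans (cong₂ ℤ._-_ (eq (x ◂ w)) (eq x)) (lemma b (g (x ◂ w)) (g x))
    where
    lemma : ∀ b p q → b ℤ.* p ℤ.- b ℤ.* q ≡ b ℤ.* (p ℤ.- q)
    lemma = solve-∀

  torsion-cong : ∀ {g h} → Torsion _◂_ D g → (∀ x → h x ≡ g x) → Torsion _◂_ D h
  torsion-cong t eq = torsion-scale 1ℤ t λ x → trans (eq x) (sym (ℤₚ.*-identityˡ _))

  module _ (comm : ∀ x v w → (x ◂ v) ◂ w ≡ (x ◂ w) ◂ v) where

    difference-comm : ∀ v w f x → difference _◂_ v (difference _◂_ w f) x ≡ difference _◂_ w (difference _◂_ v f) x
    difference-comm v w f x rewrite comm x v w =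
      lemma (f ((x ◂ w) ◂ v)) (f (x ◂ v)) (f (x ◂ w)) (f x)
      where
      lemma : ∀ a b c d → (a ℤ.- b) ℤ.- (c ℤ.- d) ≡ (a ℤ.- c) ℤ.- (b ℤ.- d)
      lemma = solve-∀

    torsion-difference : ∀ v {f} → Torsion _◂_ D f → Torsion _◂_ D (difference _◂_ v f)
    torsion-difference v (vanish z) = vanish λ x → cong₂ ℤ._-_ (z (x ◂ v)) (z x)
    torsion-difference v {f} (along w Dw t) =
      along w Dw (torsion-cong (torsion-difference v t) (difference-comm w v f))

    -- The certificates are concatenated: the operators killing `f` come first, and since
    -- translations commute they keep `g` torsion; then the operators killing `g` finish.
    torsion-+ : ∀ b {f g h} → Torsion _◂_ D f → Torsion _◂_ D g → (∀ x → h x ≡ f x ℤ.+ b ℤ.* g x) →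
                Torsion _◂_ D h
    torsion-+ b {f} {g} (vanish z) t eq = torsion-scale b t λ x →
      trans (eq x) (trans (cong (ℤ._+ b ℤ.* g x) (z x)) (ℤₚ.+-identityˡ _))
    torsion-+ b {f} {g} (along w Dw s) t eq = along w Dw $ torsion-+ b s (torsion-difference w t) λ x →
      trans (cong₂ ℤ._-_ (eq (x ◂ w)) (eq x)) (lemma b (f (x ◂ w)) (f x) (g (x ◂ w)) (g x))
      where
      lemma : ∀ b p q r s → (p ℤ.+ b ℤ.* r) ℤ.- (q ℤ.+ b ℤ.* s) ≡ (p ℤ.- q) ℤ.+ b ℤ.* (r ℤ.- s)
      lemma = solve-∀

⊕-comm₂ : ∀ {d} (x v w : Vec ℤ d) → x ⊕ v ⊕ w ≡ x ⊕ w ⊕ v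
⊕-comm₂ x v w = trans (zipWith-assoc ℤₚ.+-assoc x v w)
  (trans (cong (x ⊕_) (zipWith-comm ℤₚ.+-comm v w)) (sym (zipWith-assoc ℤₚ.+-assoc x w v)))

literal : Bool → ℤ → ℤ
literal true  (+ _)    = 1ℤ
literal true  -[1+ _ ] = 0ℤ
literal false (+ _)    = 0ℤ
literal false -[1+ _ ] = 1ℤ

literal-not : ∀ b t → literal b t ≡ 1ℤ ℤ.- literal (not b) t
literal-not true  (+ _)    = refl
literal-not true  -[1+ _ ] = refl
literal-not false (+ _)    = refl
literal-not false -[1+ _ ] = refl

Literals : ℕ → Set
Literals d = List (Bool × Vec ℤ d)

⟦_⟧ : ∀ {d} → Literals d → Vec ℤ d → ℤ
⟦ [] ⟧ z = 1ℤ
⟦ (b , a) ∷ S ⟧ z = literal b (a ∙ z) ℤ.* ⟦ S ⟧ z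

negateLiteral : ∀ {d} → Bool × Vec ℤ d → Bool × Vec ℤ d
negateLiteral = map₁ not

negate : ∀ {d} → Literals d → Literals d
negate = List.map negateLiteral

-- Lists of literals are traversed as a zipper `R ʳ++ S`: moving the head of `S` onto `R` holds by
-- computation, and the product ignores the order.
⟦⟧-ʳ++ : ∀ {d} (R S : Literals d) z → ⟦ R ʳ++ S ⟧ z ≡ ⟦ R ⟧ z ℤ.* ⟦ S ⟧ z
⟦⟧-ʳ++ [] S z = sym (ℤₚ.*-identityˡ _)
⟦⟧-ʳ++ ((b , a) ∷ R) S z rewrite ⟦⟧-ʳ++ R ((b , a) ∷ S) z =
  lemma (⟦ R ⟧ z) (literal b (a ∙ z)) (⟦ S ⟧ z)
  where
  lemma : ∀ r l s → r ℤ.* (l ℤ.* s) ≡ (l ℤ.* r) ℤ.* s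
  lemma = solve-∀

-- Expanding one factor as h = 1 - (1 - h): changing a sign costs a product with that factor left
-- out.
⟦⟧-flip : ∀ {d} (R S : Literals d) b a z →
  ⟦ R ʳ++ (b , a) ∷ S ⟧ z ≡ ⟦ R ʳ++ S ⟧ z ℤ.- ⟦ R ʳ++ (not b , a) ∷ S ⟧ z
⟦⟧-flip R S b a z
  rewrite ⟦⟧-ʳ++ R ((b , a) ∷ S) z | ⟦⟧-ʳ++ R S z | ⟦⟧-ʳ++ R ((not b , a) ∷ S) z
        | literal-not b (a ∙ z) = lemma (⟦ R ⟧ z) (literal (not b) (a ∙ z)) (⟦ S ⟧ z)
  where
  lemma : ∀ r l s → r ℤ.* ((1ℤ ℤ.- l) ℤ.* s) ≡ r ℤ.* s ℤ.- r ℤ.* (l ℤ.* s)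
  lemma = solve-∀

⟦⟧-invariant : ∀ {d} (S : Literals d) w z →
  ListAll.All (λ l → proj₂ l ∙ w ≡ 0ℤ) S → ⟦ S ⟧ (z ⊕ w) ≡ ⟦ S ⟧ z
⟦⟧-invariant [] w z ListAll.[] = refl
⟦⟧-invariant ((b , a) ∷ S) w z (p ListAll.∷ ps) = cong₂ ℤ._*_
  (cong (literal b) (trans (∙-⊕ a z w) (trans (cong (λ t → a ∙ z ℤ.+ t) p) (ℤₚ.+-identityʳ _))))
  (⟦⟧-invariant S w z ps)

-- In Matches λs as S the literal of aᵢ has a sign for which λᵢ (aᵢ · z) ≥ 0 wherever it holds.
data Matches {d} : ∀ {s} → Vec ℤ s → Vec (Vec ℤ d) s → Literals d → Set where
  []   : Matches [] [] []
  _∷⁺_ : ∀ {s l a} {λs : Vec ℤ s} {as S} → 0ℤ ℤ.≤ l → Matches λs as S →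
         Matches (l ∷ λs) (a ∷ as) ((true , a) ∷ S)
  _∷⁻_ : ∀ {s l a} {λs : Vec ℤ s} {as S} → l ℤ.≤ 0ℤ → Matches λs as S →
         Matches (l ∷ λs) (a ∷ as) ((false , a) ∷ S)

-- Where the product is nonzero every literal holds, so every term λᵢ (aᵢ · z) is nonnegative. A
-- negative λᵢ comes with the strict condition aᵢ · z < 0, which makes its term positive; a positive
-- λᵢ would not, as aᵢ · z may be 0.
matches-sum : ∀ {d s} {λs : Vec ℤ s} {as : Vec (Vec ℤ d) s} {S} z → Matches λs as S →
  ⟦ S ⟧ z ≡ 0ℤ ⊎ (0ℤ ℤ.≤ pairing λs as z × (Any (ℤ._< 0ℤ) λs → 0ℤ ℤ.< pairing λs as z))
matches-sum z [] = inj₂ (ℤₚ.≤-refl , λ ())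
matches-sum z (_∷⁺_ {l = + l} {a} _ M) with a ∙ z | matches-sum z M
... | -[1+ _ ] | _ = inj₁ refl
... | + _ | inj₁ p rewrite p = inj₁ refl
... | + t | inj₂ (p , q) rewrite sym (ℤₚ.pos-* l t) =
  inj₂ (ℤₚ.+-mono-≤ {0ℤ} {+ (l ℕ.* t)} {0ℤ} (ℤ.+≤+ z≤n) p , λ { (there i) → ℤₚ.+-mono-≤-< {0ℤ} {+ (l ℕ.* t)} {0ℤ} (ℤ.+≤+ z≤n) (q i) ; (here (ℤ.+<+ ())) })
matches-sum z (_∷⁻_ {l = l} {a} l≤0 M) with a ∙ z | matches-sum z M
... | + _ | _ = inj₁ refl
... | -[1+ _ ] | inj₁ p rewrite p = inj₁ refl
matches-sum z (_∷⁻_ {l = + zero} {a} l≤0 M) | -[1+ t ] | inj₂ (p , q) =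
  inj₂ (ℤₚ.+-mono-≤ {0ℤ} {0ℤ} {0ℤ} (ℤ.+≤+ z≤n) p , λ { (there i) → ℤₚ.+-mono-≤-< {0ℤ} {0ℤ} {0ℤ} (ℤ.+≤+ z≤n) (q i) ; (here (ℤ.+<+ ())) })
matches-sum z (_∷⁻_ {l = + suc _} {a} (ℤ.+≤+ ()) M) | -[1+ t ] | inj₂ (p , q)
matches-sum z (_∷⁻_ {l = -[1+ l ]} {a} l≤0 M) | -[1+ t ] | inj₂ (p , q) =
  inj₂ (ℤₚ.<⇒≤ 0<s , λ _ → 0<s)
  where
  0<s = ℤₚ.+-mono-<-≤ {0ℤ} {+ (suc l ℕ.* suc t)} {0ℤ} (ℤ.+<+ (s≤s z≤n)) p

matches-vanish : ∀ {d s} {λs : Vec ℤ s} {as : Vec (Vec ℤ d) s} {S} z → Matches λs as S →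
  Any (ℤ._< 0ℤ) λs → pairing λs as z ≡ 0ℤ → ⟦ S ⟧ z ≡ 0ℤ
matches-vanish z M any sum≡0 with matches-sum z M
... | inj₁ p = p
... | inj₂ (_ , q) = ⊥-elim (ℤₚ.<-irrefl (sym sum≡0) (q any))

-- Without a negative coefficient, the sum at `q` has only nonnegative terms, and a nonzero
-- coefficient makes it positive. So a nontrivial relation has a negative coefficient.
negative-coefficient : ∀ {d s} (λs : Vec ℤ s) (as : Vec (Vec ℤ d) s) q → All (λ a → 0ℤ ℤ.< a ∙ q) as →
  Any (ℤ._< 0ℤ) λs ⊎ (0ℤ ℤ.≤ pairing λs as q × (λs ≢ 0ᵥ → 0ℤ ℤ.< pairing λs as q))
negative-coefficient [] [] q [] = inj₂ (ℤₚ.≤-refl , λ ≢ → ⊥-elim (≢ refl))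
negative-coefficient (-[1+ _ ] ∷ λs) (a ∷ as) q (_ ∷ ps) = inj₁ (here ℤ.-<+)
negative-coefficient (+ l ∷ λs) (a ∷ as) q (p ∷ ps) with a ∙ q | negative-coefficient λs as q ps
... | _ | inj₁ any = inj₁ (there any)
negative-coefficient (+ zero ∷ λs) (a ∷ as) q (p ∷ ps) | x | inj₂ (u , v) =
  inj₂ (subst (0ℤ ℤ.≤_) (sym (ℤₚ.+-identityˡ _)) u ,
        λ ≢ → subst (0ℤ ℤ.<_) (sym (ℤₚ.+-identityˡ _)) (v (≢ ∘ cong (0ℤ ∷_))))
negative-coefficient (+ suc l ∷ λs) (a ∷ as) q (p ∷ ps) | + zero | inj₂ (u , v) = ⊥-elim (ℤₚ.<-irrefl refl p)
negative-coefficient (+ suc l ∷ λs) (a ∷ as) q (p ∷ ps) | + suc x | inj₂ (u , v) =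
  inj₂ (ℤₚ.<⇒≤ 0<s , λ _ → 0<s)
  where
  0<s = ℤₚ.+-mono-<-≤ {0ℤ} {+ (suc l ℕ.* suc x)} {0ℤ} (ℤ.+<+ (s≤s z≤n)) u

pairing-neg : ∀ {d s} (λs : Vec ℤ s) (as : Vec (Vec ℤ d) s) z →
  pairing (map (ℤ.-_) λs) as z ≡ ℤ.- pairing λs as z
pairing-neg [] [] z = refl
pairing-neg (l ∷ λs) (a ∷ as) z rewrite pairing-neg λs as z = lemma l (a ∙ z) (pairing λs as z)
  where
  lemma : ∀ l x y → ℤ.- l ℤ.* x ℤ.- y ≡ ℤ.- (l ℤ.* x ℤ.+ y)
  lemma = solve-∀

-- A zero coefficient admits either literal, so a single choice `S` serves λ while its negation
-- serves -λ.
matching : ∀ {d s} (λs : Vec ℤ s) (as : Vec (Vec ℤ d) s) →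
  ∃[ S ] Vec.toList as ≡ List.map proj₂ S × Matches λs as S × Matches (map (ℤ.-_) λs) as (negate S)
matching [] [] = [] , refl , [] , []
matching (l ∷ λs) (a ∷ as) with matching λs as | ℤₚ.≤-total 0ℤ l
... | S , eq , M , N | inj₁ 0≤l =
  (true , a) ∷ S , cong (a ∷_) eq , 0≤l ∷⁺ M , ℤₚ.neg-mono-≤ 0≤l ∷⁻ N
... | S , eq , M , N | inj₂ l≤0 =
  (false , a) ∷ S , cong (a ∷_) eq , l≤0 ∷⁻ M , ℤₚ.neg-mono-≤ l≤0 ∷⁺ N

map-neg≢0 : ∀ {s} (λs : Vec ℤ s) → λs ≢ 0ᵥ → map (ℤ.-_) λs ≢ 0ᵥ
map-neg≢0 λs ≢ eq = ≢ (lemma λs eq)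
  where
  lemma : ∀ {s} (λs : Vec ℤ s) → map (ℤ.-_) λs ≡ 0ᵥ → λs ≡ 0ᵥ
  lemma [] _ = refl
  lemma (l ∷ λs) eq = cong₂ _∷_ (ℤₚ.neg-injective (proj₁ (∷-injective eq))) (lemma λs (proj₂ (∷-injective eq)))

-- Both λ and -λ are nontrivial relations among functionals positive at `q`, so each has a negative
-- coefficient. The first makes the product of `S` vanish, the second that of `negate S`.
vanishing-signs : ∀ {d} (as : List (Vec ℤ d)) q → d ℕ.< length as →
  ListAll.All (λ a → 0ℤ ℤ.< a ∙ q) as →
  ∃[ S ] List.map proj₂ S ≡ as × (∀ z → ⟦ S ⟧ z ≡ 0ℤ) × (∀ z → ⟦ negate S ⟧ z ≡ 0ℤ)
vanishing-signs {d} as q d<s pos with dependence d<s (Vec.fromList as)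
... | λs , λs≢0 , zero-sum with matching λs (Vec.fromList as)
... | S , eq , M , N =
  S , trans (sym eq) (toList∘fromList as) ,
  (λ z → matches-vanish z M (negative λs λs≢0 zero-sum) (zero-sum z)) ,
  (λ z → matches-vanish z N (negative _ (map-neg≢0 λs λs≢0) zero-sum⁻) (zero-sum⁻ z))
  where
  zero-sum⁻ : ∀ z → pairing (map (ℤ.-_) λs) (Vec.fromList as) z ≡ 0ℤ
  zero-sum⁻ z = trans (pairing-neg λs (Vec.fromList as) z) (cong ℤ.-_ (zero-sum z))
  negative : ∀ μs → μs ≢ 0ᵥ → (∀ z → pairing μs (Vec.fromList as) z ≡ 0ℤ) → Any (ℤ._< 0ℤ) μs
  negative μs μs≢0 sum≡0 with negative-coefficient μs (Vec.fromList as) q (Allₚ.fromList⁺ pos)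
  ... | inj₁ any = any
  ... | inj₂ (_ , 0<) = ⊥-elim (ℤₚ.<-irrefl (sym (sum≡0 q)) (0< μs≢0))

-- Reciprocity for products of literals

PositiveAt : ∀ {d} → Vec ℤ d → Literals d → Set
PositiveAt q = ListAll.All (λ l → 0ℤ ℤ.< proj₂ l ∙ q)

positive-ʳ++ : ∀ {d} {q : Vec ℤ d} {R T} → PositiveAt q R → PositiveAt q T → PositiveAt q (R ʳ++ T)
positive-ʳ++ ListAll.[] pT = pT
positive-ʳ++ (p ListAll.∷ pR) pT = positive-ʳ++ pR (p ListAll.∷ pT)

module _ (k : ℤ) (k≢0 : k ≢ 0ℤ) (n : ℕ) where

  -- Heights move by multiples of k only, so that translations preserve each residue class of
  -- heights modulo k and act on the index l of height lk + r.
  Direction : Vec ℤ (suc n) → Set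
  Direction w = w ≢ 0ᵥ × ∃[ e ] Vec.head w ≡ e ℤ.* k

  TorsionVec : (Vec ℤ (suc n) → ℤ) → Set
  TorsionVec = Torsion _⊕_ Direction

  Reciprocal : Literals (suc n) → Set
  Reciprocal S = TorsionVec (λ z → ⟦ S ⟧ z ℤ.- -1ℤ ℤ.^ suc n ℤ.* ⟦ negate S ⟧ z)

  few-literals : ∀ S → length S ℕ.< suc n → TorsionVec ⟦ S ⟧
  few-literals S s<d
    with commonKernel (subst (ℕ._< suc n) (sym (length-map proj₂ S)) s<d) (Vec.fromList (List.map proj₂ S))
  -- The kernel vector has an arbitrary height e; scaling it by k makes the height a multiple of k.
  ... | w@(e ∷ _) , w≢0 , zs = along (k ⊡ w) (w≢0 ∘ ⊡≡0 k w k≢0 , e , ℤₚ.*-comm k e) $ vanish λ z →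
    ℤₚ.i≡j⇒i-j≡0 (⟦⟧-invariant S (k ⊡ w) z (ListAll.map (λ {l} → scaled l) (ListAllₚ.map⁻ (Allₚ.fromList⁻ zs))))
    where
    scaled : ∀ (l : Bool × Vec ℤ (suc n)) → proj₂ l ∙ w ≡ 0ℤ → proj₂ l ∙ (k ⊡ w) ≡ 0ℤ
    scaled (_ , a) p = trans (∙-⊡ a k w) (trans (cong (k ℤ.*_) p) (ℤₚ.*-zeroʳ k))

  reciprocal-few : ∀ S → length S ℕ.< suc n → Reciprocal S
  reciprocal-few S s<d = torsion-+ ⊕-comm₂ (ℤ.- (-1ℤ ℤ.^ suc n)) (few-literals S s<d)
    (few-literals (negate S) (subst (ℕ._< suc n) (sym (length-map _ S)) s<d))
    λ z → cong (λ t → ⟦ S ⟧ z ℤ.+ t) (ℤₚ.neg-distribˡ-* (-1ℤ ℤ.^ suc n) (⟦ negate S ⟧ z))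

  -- Π hᵢ - Π (hᵢ - 1) telescopes into products with one factor left out.
  reciprocal-square : ∀ R T → length R ℕ.+ length T ≡ suc n →
    TorsionVec (λ z → ⟦ R ʳ++ T ⟧ z ℤ.- -1ℤ ℤ.^ length T ℤ.* ⟦ R ʳ++ negate T ⟧ z)
  reciprocal-square R [] _ = vanish λ z → trans (cong (λ t → ⟦ R ʳ++ [] ⟧ z ℤ.- t) (ℤₚ.*-identityˡ _)) (ℤₚ.+-inverseʳ (⟦ R ʳ++ [] ⟧ z))
  reciprocal-square R ((b , a) ∷ T) eq = torsion-+ ⊕-comm₂ -1ℤ
    (few-literals (R ʳ++ T) (ℕₚ.≤-reflexive (trans (cong suc (length-ʳ++ R)) eq′)))
    (reciprocal-square ((not b , a) ∷ R) T eq′)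
    λ z → trans (cong (ℤ._- -1ℤ ℤ.^ suc (length T) ℤ.* ⟦ R ʳ++ negate ((b , a) ∷ T) ⟧ z) (⟦⟧-flip R T b a z))
      (lemma (⟦ R ʳ++ T ⟧ z) (⟦ R ʳ++ (not b , a) ∷ T ⟧ z) (-1ℤ ℤ.^ length T) (⟦ R ʳ++ (not b , a) ∷ negate T ⟧ z))
    where
    eq′ : suc (length R ℕ.+ length T) ≡ suc n
    eq′ = trans (sym (ℕₚ.+-suc (length R) (length T))) eq
    lemma : ∀ p q s r → (p ℤ.- q) ℤ.- (-1ℤ ℤ.* s) ℤ.* r ≡ p ℤ.+ -1ℤ ℤ.* (q ℤ.- s ℤ.* r)
    lemma = solve-∀

  -- Negating all literals respects the expansion of one factor, so the difference in `Reciprocal`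
  -- for sign b is that of the shorter product minus that for the opposite sign.
  reciprocal-flip : ∀ R T b a → Reciprocal (R ʳ++ T) → Reciprocal (R ʳ++ (not b , a) ∷ T) →
    Reciprocal (R ʳ++ (b , a) ∷ T)
  reciprocal-flip R T b a r₁ r₂ = torsion-+ ⊕-comm₂ -1ℤ r₁ r₂ λ z → trans
    (cong₂ (λ p q → p ℤ.- -1ℤ ℤ.^ suc n ℤ.* q) (⟦⟧-flip R T b a z) (flip-negated z))
    (lemma (-1ℤ ℤ.^ suc n) (⟦ R ʳ++ T ⟧ z) (⟦ R ʳ++ (not b , a) ∷ T ⟧ z) (⟦ negate (R ʳ++ T) ⟧ z) (⟦ negate (R ʳ++ (not b , a) ∷ T) ⟧ z))
    where
    lemma : ∀ s p q r t → (p ℤ.- q) ℤ.- s ℤ.* (r ℤ.- t) ≡ (p ℤ.- s ℤ.* r) ℤ.+ -1ℤ ℤ.* (q ℤ.- s ℤ.* t)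
    lemma = solve-∀
    flip-negated : ∀ z → ⟦ negate (R ʳ++ (b , a) ∷ T) ⟧ z ≡
      ⟦ negate (R ʳ++ T) ⟧ z ℤ.- ⟦ negate (R ʳ++ (not b , a) ∷ T) ⟧ z
    flip-negated z
      rewrite map-ʳ++ negateLiteral R {(b , a) ∷ T} | map-ʳ++ negateLiteral R {T}
            | map-ʳ++ negateLiteral R {(not b , a) ∷ T}
      = ⟦⟧-flip (negate R) (negate T) (not b) a z

  module _ (q : Vec ℤ (suc n)) where

    -- `T` and `T′` carry the same functionals with different signs. The tail is corrected first,
    -- behind the old sign of the head; then the head is flipped if its signs disagree, and
    -- `shorter` pays for the product without it.
    reciprocal-resign : ∀ R T T′ → List.map proj₂ T ≡ List.map proj₂ T′ → PositiveAt q R → PositiveAt q T →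
      (∀ S → length S ℕ.< length R ℕ.+ length T → PositiveAt q S → Reciprocal S) →
      Reciprocal (R ʳ++ T′) → Reciprocal (R ʳ++ T)
    reciprocal-resign R [] [] _ _ _ _ r = r
    reciprocal-resign R ((b , a) ∷ T) ((b′ , a′) ∷ T′) eq pR (p ListAll.∷ pT) shorter r
      with Listₚ.∷-injective eq
    ... | refl , eq′ with resigned ← reciprocal-resign ((b′ , a) ∷ R) T T′ eq′ (p ListAll.∷ pR) pT
                             (λ S lt → shorter S (subst (length S ℕ.<_) (sym (ℕₚ.+-suc (length R) (length T))) lt)) r
                       | b Bool.≟ b′
    ... | yes refl = resigned
    ... | no b≢b′ with refl ← ¬-not (b≢b′ ∘ sym) = reciprocal-flip R T b a
      (shorter (R ʳ++ T) (ℕₚ.≤-reflexive (trans (cong suc (length-ʳ++ R)) (sym (ℕₚ.+-suc (length R) (length T))))) (positive-ʳ++ pR pT))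
      resigned

    -- Strong induction on the number of factors, with `N` as its bound; the cases compare this
    -- number with the dimension n + 1.
    reciprocal-bounded : ∀ N S → length S ℕ.≤ N → PositiveAt q S → Reciprocal S
    reciprocal-bounded N S s≤N pS with ℕₚ.<-cmp (length S) (suc n)
    ... | tri< s<d _ _ = reciprocal-few S s<d
    ... | tri≈ _ s≡d _ = subst (λ e → TorsionVec (λ z → ⟦ S ⟧ z ℤ.- -1ℤ ℤ.^ e ℤ.* ⟦ negate S ⟧ z)) s≡d
                           (reciprocal-square [] S s≡d)
    reciprocal-bounded zero [] s≤N pS | tri> _ _ ()
    reciprocal-bounded (suc N) S s≤N pS | tri> _ _ d<s
      with vanishing-signs (List.map proj₂ S) q (subst (suc n ℕ.<_) (sym (length-map proj₂ S)) d<s) (ListAllₚ.map⁺ pS)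
    -- For the signs `S₀` both products are identically zero, which starts the change of signs from
    -- `S₀` to `S`.
    ... | S₀ , eq , zero₁ , zero₂ = reciprocal-resign [] S S₀ (sym eq) ListAll.[] pS
      (λ S′ lt pS′ → reciprocal-bounded N S′ (ℕₚ.≤-pred (ℕₚ.≤-trans lt s≤N)) pS′)
      (vanish λ z → trans (cong₂ (λ p q → p ℤ.- -1ℤ ℤ.^ suc n ℤ.* q) (zero₁ z) (zero₂ z)) (cong (λ t → 0ℤ ℤ.- t) (ℤₚ.*-zeroʳ (-1ℤ ℤ.^ suc n))))

    reciprocal : ∀ S → PositiveAt q S → Reciprocal S
    reciprocal S = reciprocal-bounded (length S) S ℕₚ.≤-refl

-- Finite sums over fibres

module _ {X : Set} where

  sumOver : (X → ℤ) → List X → ℤ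
  sumOver g [] = 0ℤ
  sumOver g (x ∷ xs) = g x ℤ.+ sumOver g xs

  -- The sum of a finitely supported function over all of `X`. The list may contain zeros of `g`, so
  -- one list can serve several functions.
  IsSum : (X → ℤ) → ℤ → Set
  IsSum g s = ∃[ L ] Unique L × (∀ x → g x ≢ 0ℤ → x ∈ L) × sumOver g L ≡ s

  sumOver-↭ : ∀ g {xs ys} → xs ↭ ys → sumOver g xs ≡ sumOver g ys
  sumOver-↭ g Perm.refl = refl
  sumOver-↭ g (Perm.prep x p) = cong (λ t → g x ℤ.+ t) (sumOver-↭ g p)
  sumOver-↭ g (Perm.swap {xs} {ys} x y p) rewrite sumOver-↭ g p = lemma (g x) (g y) (sumOver g ys)
    where
    lemma : ∀ a b c → a ℤ.+ (b ℤ.+ c) ≡ b ℤ.+ (a ℤ.+ c)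
    lemma = solve-∀
  sumOver-↭ g (Perm.trans p q) = trans (sumOver-↭ g p) (sumOver-↭ g q)

  nonzero? : ∀ (g : X → ℤ) x → Dec (g x ≢ 0ℤ)
  nonzero? g x = ¬? (g x ℤ.≟ 0ℤ)

  sumOver-support : ∀ g xs → sumOver g xs ≡ sumOver g (filter (nonzero? g) xs)
  sumOver-support g [] = refl
  sumOver-support g (x ∷ xs) with g x ℤ.≟ 0ℤ
  ... | yes gx≡0 = trans (cong₂ ℤ._+_ gx≡0 (sumOver-support g xs)) (ℤₚ.+-identityˡ _)
  ... | no  gx≢0 = cong (λ t → g x ℤ.+ t) (sumOver-support g xs)

  -- Independence of the list: with the zeros removed, two duplicate-free lists covering the support
  -- have the same members and are permutations of each other.
  isSum-over : ∀ {g s xs} → IsSum g s → Unique xs → (∀ x → g x ≢ 0ℤ → x ∈ xs) → sumOver g xs ≡ s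
  isSum-over {g} {s} {xs} (ys , unique-ys , covers-ys , refl) unique-xs covers-xs =
    trans (sumOver-support g xs) (trans
      (sumOver-↭ g (∼bag⇒↭ (unique∧set⇒bag (Uniqueₚ.filter⁺ (nonzero? g) unique-xs) (Uniqueₚ.filter⁺ (nonzero? g) unique-ys)
        (mk⇔ (restrict xs covers-ys) (restrict ys covers-xs)))))
      (sym (sumOver-support g ys)))
    where
    restrict : ∀ us {vs} → (∀ x → g x ≢ 0ℤ → x ∈ vs) → ∀ {x} →
      x ∈ filter (nonzero? g) us → x ∈ filter (nonzero? g) vs
    restrict us covers {x} x∈ with ∈-filter⁻ (nonzero? g) {xs = us} x∈
    ... | _ , gx≢0 = ∈-filter⁺ (nonzero? g) (covers x gx≢0) gx≢0

  sumOver-linear : ∀ b f g h → (∀ x → h x ≡ f x ℤ.+ b ℤ.* g x) → ∀ xs →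
    sumOver h xs ≡ sumOver f xs ℤ.+ b ℤ.* sumOver g xs
  sumOver-linear b f g h eq [] = sym (trans (ℤₚ.+-identityˡ _) (ℤₚ.*-zeroʳ b))
  sumOver-linear b f g h eq (x ∷ xs) rewrite eq x | sumOver-linear b f g h eq xs =
    lemma b (f x) (g x) (sumOver f xs) (sumOver g xs)
    where
    lemma : ∀ b p q r s → (p ℤ.+ b ℤ.* q) ℤ.+ (r ℤ.+ b ℤ.* s) ≡ (p ℤ.+ r) ℤ.+ b ℤ.* (q ℤ.+ s)
    lemma = solve-∀

  module _ (_≟_ : DecidableEquality X) where

    isSum-linear : ∀ b {f g h s t} → IsSum f s → IsSum g t → (∀ x → h x ≡ f x ℤ.+ b ℤ.* g x) →
      IsSum h (s ℤ.+ b ℤ.* t)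
    isSum-linear b {f} {g} {h} F@(xs , _ , covers-f , _) G@(ys , _ , covers-g , _) eq =
      zs , deduplicate-! _≟_ (xs ++ ys) , covers-h ,
      trans (sumOver-linear b f g h eq zs)
        (cong₂ (λ p q → p ℤ.+ b ℤ.* q) (isSum-over F unique-zs covers-f′) (isSum-over G unique-zs covers-g′))
      where
      -- This list covers the supports of `f`, `g` and `h` at once.
      zs = deduplicate _≟_ (xs ++ ys)
      unique-zs = deduplicate-! _≟_ (xs ++ ys)
      covers-f′ : ∀ x → f x ≢ 0ℤ → x ∈ zs
      covers-f′ x fx≢0 = ∈-deduplicate⁺ _≟_ (∈-++⁺ˡ (covers-f x fx≢0))
      covers-g′ : ∀ x → g x ≢ 0ℤ → x ∈ zs
      covers-g′ x gx≢0 = ∈-deduplicate⁺ _≟_ (∈-++⁺ʳ xs (covers-g x gx≢0))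
      covers-h : ∀ x → h x ≢ 0ℤ → x ∈ zs
      covers-h x hx≢0 with f x ℤ.≟ 0ℤ | g x ℤ.≟ 0ℤ
      ... | no fx≢0 | _ = covers-f′ x fx≢0
      ... | yes _ | no gx≢0 = covers-g′ x gx≢0
      ... | yes fx≡0 | yes gx≡0 = ⊥-elim (hx≢0 (trans (eq x)
              (trans (cong₂ (λ p q → p ℤ.+ b ℤ.* q) fx≡0 gx≡0) (trans (ℤₚ.+-identityˡ _) (ℤₚ.*-zeroʳ b)))))

  isSum-reindex : ∀ {f g s} (σ τ : X → X) → (∀ x → τ (σ x) ≡ x) → (∀ x → σ (τ x) ≡ x) →
    IsSum f s → (∀ x → g x ≡ f (σ x)) → IsSum g s
  isSum-reindex {f} {g} σ τ τσ στ (xs , unique , covers , refl) eq =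
    List.map τ xs ,
    Uniqueₚ.map⁺ (λ {x} {y} p → trans (sym (στ x)) (trans (cong σ p) (στ y))) unique ,
    (λ x gx≢0 → subst (_∈ List.map τ xs) (τσ x) (∈-map⁺ τ (covers (σ x) (gx≢0 ∘ trans (eq x))))) ,
    sum-map xs
    where
    sum-map : ∀ xs → sumOver g (List.map τ xs) ≡ sumOver f xs
    sum-map [] = refl
    sum-map (x ∷ xs) = cong₂ ℤ._+_ (trans (eq (τ x)) (cong f (στ x))) (sum-map xs)

-- Finite fibres and the removal of horizontal directions

⊖_ : ∀ {d} → Vec ℤ d → Vec ℤ d
⊖_ = map (ℤ.-_)

⊕-cancel : ∀ {d} (x v : Vec ℤ d) → x ⊕ v ⊕ ⊖ v ≡ x
⊕-cancel x v = trans (zipWith-assoc ℤₚ.+-assoc x v (⊖ v))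
  (trans (cong (x ⊕_) (zipWith-inverseʳ ℤₚ.+-inverseʳ v)) (zipWith-identityʳ ℤₚ.+-identityʳ x))

⊖-cancel : ∀ {d} (x v : Vec ℤ d) → x ⊕ ⊖ v ⊕ v ≡ x
⊖-cancel x v = trans (⊕-comm₂ x (⊖ v) v) (⊕-cancel x v)

0≤x∙x : ∀ {d} (x : Vec ℤ d) → 0ℤ ℤ.≤ x ∙ x
0≤x∙x [] = ℤₚ.≤-refl
0≤x∙x (+ x ∷ xs) rewrite sym (ℤₚ.pos-* x x) = ℤₚ.+-mono-≤ {0ℤ} {+ (x ℕ.* x)} {0ℤ} (ℤ.+≤+ z≤n) (0≤x∙x xs)
0≤x∙x (-[1+ x ] ∷ xs) = ℤₚ.+-mono-≤ {0ℤ} {+ (suc x ℕ.* suc x)} {0ℤ} (ℤ.+≤+ z≤n) (0≤x∙x xs)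

0<x∙x : ∀ {d} (x : Vec ℤ d) → x ≢ 0ᵥ → 0ℤ ℤ.< x ∙ x
0<x∙x [] x≢0 = ⊥-elim (x≢0 refl)
0<x∙x (+ zero ∷ xs) x≢0 = subst (0ℤ ℤ.<_) (sym (ℤₚ.+-identityˡ _)) (0<x∙x xs (x≢0 ∘ cong (0ℤ ∷_)))
0<x∙x (+ suc x ∷ xs) x≢0 = ℤₚ.+-mono-<-≤ {0ℤ} {+ (suc x ℕ.* suc x)} {0ℤ} (ℤ.+<+ (s≤s z≤n)) (0≤x∙x xs)
0<x∙x (-[1+ x ] ∷ xs) x≢0 = ℤₚ.+-mono-<-≤ {0ℤ} {+ (suc x ℕ.* suc x)} {0ℤ} (ℤ.+<+ (s≤s z≤n)) (0≤x∙x xs)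

i≤+∣i∣ : ∀ i → i ℤ.≤ + ℤ.∣ i ∣
i≤+∣i∣ (+ _)    = ℤₚ.≤-refl
i≤+∣i∣ -[1+ _ ] = ℤ.-≤+

bounded-on-list : ∀ {X : Set} (μ : X → ℤ) (xs : List X) → ∃[ B ] ∀ {x} → x ∈ xs → μ x ℤ.≤ B
bounded-on-list μ [] = 0ℤ , λ ()
bounded-on-list μ (x ∷ xs) with bounded-on-list μ xs
... | B , bound = μ x ℤ.⊔ B , λ
  { (here refl) → ℤₚ.i≤i⊔j (μ x) B
  ; (there x∈xs) → ℤₚ.≤-trans (bound x∈xs) (ℤₚ.i≤j⊔i (μ x) B) }

-- Each translation by `v` raises v · x by v · v ≥ 1, while v · x is bounded on the support. After
-- enough translations the value is 0, and periodicity carries it back to x.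
finite-periodic≡0 : ∀ {d} (g : Vec ℤ d → ℤ) v → v ≢ 0ᵥ → (∀ x → g (x ⊕ v) ≡ g x) →
  ∀ xs → (∀ x → g x ≢ 0ℤ → x ∈ xs) → ∀ x → g x ≡ 0ℤ
finite-periodic≡0 {d} g v v≢0 periodic xs covers x with bounded-on-list (v ∙_) xs
... | B , bound = descend _ x (start (v ∙ x))
  where
  start : ∀ t → B ℤ.< t ℤ.+ + suc ℤ.∣ B ℤ.- t ∣
  start t = ℤₚ.≤-<-trans (ℤₚ.≤-reflexive (lemma B t))
    (ℤₚ.+-monoʳ-< t (ℤₚ.≤-<-trans (i≤+∣i∣ (B ℤ.- t)) (ℤ.+<+ (ℕₚ.n<1+n _))))
    where
    lemma : ∀ B t → B ≡ t ℤ.+ (B ℤ.- t)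
    lemma = solve-∀
  descend : ∀ N x → B ℤ.< v ∙ x ℤ.+ + N → g x ≡ 0ℤ
  descend zero x B< with g x ℤ.≟ 0ℤ
  ... | yes gx≡0 = gx≡0
  ... | no  gx≢0 = ⊥-elim (ℤₚ.<⇒≱ B< (subst (ℤ._≤ B) (sym (ℤₚ.+-identityʳ _)) (bound (covers x gx≢0))))
  descend (suc N) x B< = trans (sym (periodic x)) (descend N (x ⊕ v) (ℤₚ.<-≤-trans B< (begin
    v ∙ x ℤ.+ + suc N          ≡⟨ lemma (v ∙ x) (+ N) ⟩
    v ∙ x ℤ.+ 1ℤ ℤ.+ + N       ≤⟨ ℤₚ.+-monoˡ-≤ (+ N) (ℤₚ.+-monoʳ-≤ (v ∙ x) (ℤₚ.i<j⇒suc[i]≤j (0<x∙x v v≢0))) ⟩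
    v ∙ x ℤ.+ v ∙ v ℤ.+ + N    ≡⟨ cong (ℤ._+ + N) (∙-⊕ v x v) ⟨
    v ∙ (x ⊕ v) ℤ.+ + N        ∎)))
    where
    open ℤₚ.≤-Reasoning
    lemma : ∀ t n → t ℤ.+ (1ℤ ℤ.+ n) ≡ t ℤ.+ 1ℤ ℤ.+ n
    lemma = solve-∀

module _ {n : ℕ} where

  FibreFinite : (Vec ℤ (suc n) → ℤ) → Set
  FibreFinite f = ∀ m → ∃[ xs ] ∀ x → f (m ∷ x) ≢ 0ℤ → x ∈ xs

  fibreFinite-difference : ∀ f w → FibreFinite f → FibreFinite (difference _⊕_ w f)
  fibreFinite-difference f (e ∷ w) finite m with finite m | finite (m ℤ.+ e)
  ... | xs , covers | ys , covers′ = xs ++ List.map (_⊕ ⊖ w) ys , cover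
    where
    cover : ∀ x → f ((m ℤ.+ e) ∷ (x ⊕ w)) ℤ.- f (m ∷ x) ≢ 0ℤ → x ∈ xs ++ List.map (_⊕ ⊖ w) ys
    cover x ≢0 with f (m ∷ x) ℤ.≟ 0ℤ | f ((m ℤ.+ e) ∷ (x ⊕ w)) ℤ.≟ 0ℤ
    ... | no p | _ = ∈-++⁺ˡ (covers x p)
    ... | yes _ | no q = ∈-++⁺ʳ xs (subst (_∈ List.map (_⊕ ⊖ w) ys) (⊕-cancel x w) (∈-map⁺ (_⊕ ⊖ w) (covers′ (x ⊕ w) q)))
    ... | yes p | yes q = ⊥-elim (≢0 (cong₂ ℤ._-_ q p))

  -- Directions that change the height. A horizontal translation preserves every fibre sum, so its
  -- difference operator says nothing about the sequence of sums.
  Oblique : ℤ → Vec ℤ (suc n) → Set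
  Oblique k w = ∃[ e ] e ≢ 0ℤ × Vec.head w ≡ e ℤ.* k

  module _ {k : ℤ} where

    -- The oblique operators commute with the horizontal one. Once they are all applied, the
    -- function is periodic along `v` on finitely supported fibres, hence zero.
    horizontal-injective : ∀ v → v ≢ 0ᵥ → ∀ {f g} → FibreFinite f → Torsion _⊕_ (Oblique k) g →
      (∀ z → g z ≡ difference _⊕_ (0ℤ ∷ v) f z) → Torsion _⊕_ (Oblique k) f
    horizontal-injective v v≢0 {f} finite (vanish g≡0) eq = vanish λ { (m ∷ x) →
      finite-periodic≡0 (λ x → f (m ∷ x)) v v≢0
        (λ x → trans (cong (λ m → f (m ∷ (x ⊕ v))) (sym (ℤₚ.+-identityʳ m)))
                     (ℤₚ.i-j≡0⇒i≡j _ _ (trans (sym (eq (m ∷ x))) (g≡0 (m ∷ x)))))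
        (proj₁ (finite m)) (proj₂ (finite m)) x }
    horizontal-injective v v≢0 {f} finite (along w ob t) eq = along w ob $
      horizontal-injective v v≢0 (fibreFinite-difference f w finite) t λ z →
        trans (cong₂ ℤ._-_ (eq (z ⊕ w)) (eq z)) (difference-comm {_◂_ = _⊕_} {D = Oblique k} ⊕-comm₂ w (0ℤ ∷ v) f z)

    drop-horizontal : (k≢0 : k ≢ 0ℤ) → ∀ {f} → FibreFinite f → Torsion _⊕_ (Direction k k≢0 n) f → Torsion _⊕_ (Oblique k) f
    drop-horizontal k≢0 finite (vanish z) = vanish z
    drop-horizontal k≢0 {f} finite (along w (w≢0 , e , eq) t) with e ℤ.≟ 0ℤ
    ... | no e≢0 = along w (e , e≢0 , eq) (drop-horizontal k≢0 (fibreFinite-difference f w finite) t)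
    drop-horizontal k≢0 {f} finite (along (_ ∷ v) (w≢0 , _ , refl) t) | yes refl rewrite ℤₚ.*-zeroˡ k =
      horizontal-injective v (w≢0 ∘ cong (0ℤ ∷_)) finite
        (drop-horizontal k≢0 (fibreFinite-difference f (0ℤ ∷ v) finite) t) λ _ → refl

    -- A translation of height e k carries the fibre over lk + r onto that over (l + e)k + r, so on
    -- fibre sums its difference operator becomes the difference by e.
    fibre-sum-torsion : ∀ r {f a} → Torsion _⊕_ (Oblique k) f →
      (∀ l → IsSum (λ x → f ((l ℤ.* k ℤ.+ r) ∷ x)) (a l)) → Torsion ℤ._+_ (_≢ 0ℤ) a
    fibre-sum-torsion r (vanish f≡0) sums = vanish λ l →
      sym (isSum-over (sums l) AllPairs.[] λ x fx≢0 → ⊥-elim (fx≢0 (f≡0 _)))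
    fibre-sum-torsion r {f} {a} (along (_ ∷ w) (e , e≢0 , refl) t) sums = along e e≢0 $
      fibre-sum-torsion r t λ l → subst (IsSum _) (cong (λ t → a (l ℤ.+ e) ℤ.+ t) (ℤₚ.-1*i≡-i (a l))) $
        isSum-linear (≡-dec ℤ._≟_) -1ℤ
          (isSum-reindex (_⊕ w) (_⊕ ⊖ w) (λ x → ⊕-cancel x w) (λ x → ⊖-cancel x w) (sums (l ℤ.+ e)) λ x → refl)
          (sums l)
          λ x → cong₂ (λ m s → f (m ∷ (x ⊕ w)) ℤ.+ s) (lemma l k r e) (sym (ℤₚ.-1*i≡-i (f ((l ℤ.* k ℤ.+ r) ∷ x))))
      where
      lemma : ∀ l k r e → l ℤ.* k ℤ.+ r ℤ.+ e ℤ.* k ≡ (l ℤ.+ e) ℤ.* k ℤ.+ r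
      lemma = solve-∀

-- Farkas’ lemma over ℚ

⟨,⟩-+ʳ : ∀ {d} (y u v : Point d) → ⟨ y , u +ᵥ v ⟩ ≡ ⟨ y , u ⟩ ℚ.+ ⟨ y , v ⟩
⟨,⟩-+ʳ [] [] [] = refl
⟨,⟩-+ʳ (y ∷ ys) (u ∷ us) (v ∷ vs) rewrite ⟨,⟩-+ʳ ys us vs =
  solve 5 (λ y u v p q → y :* (u :+ v) :+ (p :+ q) := (y :* u :+ p) :+ (y :* v :+ q)) refl
    y u v ⟨ ys , us ⟩ ⟨ ys , vs ⟩

⟨,⟩-·ʳ : ∀ {d} (y : Point d) c v → ⟨ y , c ·ᵥ v ⟩ ≡ c ℚ.* ⟨ y , v ⟩
⟨,⟩-·ʳ [] c [] = sym (ℚₚ.*-zeroʳ c)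
⟨,⟩-·ʳ (y ∷ ys) c (v ∷ vs) rewrite ⟨,⟩-·ʳ ys c vs =
  solve 4 (λ y c v p → y :* (c :* v) :+ c :* p := c :* (y :* v :+ p)) refl y c v ⟨ ys , vs ⟩

⟨,⟩-comm : ∀ {d} (x y : Point d) → ⟨ x , y ⟩ ≡ ⟨ y , x ⟩
⟨,⟩-comm [] [] = refl
⟨,⟩-comm (x ∷ xs) (y ∷ ys) = cong₂ ℚ._+_ (ℚₚ.*-comm x y) (⟨,⟩-comm xs ys)

⟨,⟩-+ˡ : ∀ {d} (u v y : Point d) → ⟨ u +ᵥ v , y ⟩ ≡ ⟨ u , y ⟩ ℚ.+ ⟨ v , y ⟩
⟨,⟩-+ˡ u v y = trans (⟨,⟩-comm (u +ᵥ v) y)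
  (trans (⟨,⟩-+ʳ y u v) (cong₂ ℚ._+_ (⟨,⟩-comm y u) (⟨,⟩-comm y v)))

⟨,⟩-·ˡ : ∀ {d} c (v y : Point d) → ⟨ c ·ᵥ v , y ⟩ ≡ c ℚ.* ⟨ v , y ⟩
⟨,⟩-·ˡ c v y = trans (⟨,⟩-comm (c ·ᵥ v) y) (trans (⟨,⟩-·ʳ y c v) (cong (c ℚ.*_) (⟨,⟩-comm y v)))

⟨,⟩-origin : ∀ {d} (y : Point d) → ⟨ y , origin ⟩ ≡ 0ℚ
⟨,⟩-origin [] = refl
⟨,⟩-origin (y ∷ ys) rewrite ⟨,⟩-origin ys | ℚₚ.*-zeroʳ y = refl

weights : ∀ {d m} → Vec ℚ m → Vec (Point d) m → Point d → ℚ
weights [] [] y = 0ℚ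
weights (c ∷ cs) (v ∷ vs) y = c ℚ.* ⟨ y , v ⟩ ℚ.+ weights cs vs y

⟨,⟩-comb : ∀ {d m} (y : Point d) (cs : Vec ℚ m) (vs : Vec (Point d) m) → ⟨ y , comb cs vs ⟩ ≡ weights cs vs y
⟨,⟩-comb y [] [] = ⟨,⟩-origin y
⟨,⟩-comb y (c ∷ cs) (v ∷ vs) = trans (⟨,⟩-+ʳ y (c ·ᵥ v) (comb cs vs)) (cong₂ ℚ._+_ (⟨,⟩-·ʳ y c v) (⟨,⟩-comb y cs vs))

0≤-+ : ∀ {p q} → 0ℚ ℚ.≤ p → 0ℚ ℚ.≤ q → 0ℚ ℚ.≤ p ℚ.+ q
0≤-+ {p} {q} 0≤p 0≤q = subst (ℚ._≤ p ℚ.+ q) (ℚₚ.+-identityˡ 0ℚ) (ℚₚ.+-mono-≤ 0≤p 0≤q)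

0≤-* : ∀ {p q} → 0ℚ ℚ.≤ p → 0ℚ ℚ.≤ q → 0ℚ ℚ.≤ p ℚ.* q
0≤-* {p} {q} 0≤p 0≤q = subst (ℚ._≤ p ℚ.* q) (ℚₚ.*-zeroʳ p) (ℚₚ.*-monoˡ-≤-nonNeg p {{ℚ.nonNegative 0≤p}} 0≤q)

weights-≥0 : ∀ {d m} {cs : Vec ℚ m} {vs : Vec (Point d) m} {y} →
  All (0ℚ ℚ.≤_) cs → All (λ v → 0ℚ ℚ.≤ ⟨ y , v ⟩) vs → 0ℚ ℚ.≤ weights cs vs y
weights-≥0 [] [] = ℚₚ.≤-refl
weights-≥0 (p ∷ ps) (q ∷ qs) = 0≤-+ (0≤-* p q) (weights-≥0 ps qs)

0<-* : ∀ {p q} → 0ℚ ℚ.< p → 0ℚ ℚ.< q → 0ℚ ℚ.< p ℚ.* q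
0<-* {p} {q} 0<p 0<q = subst (ℚ._< p ℚ.* q) (ℚₚ.*-zeroʳ p) (ℚₚ.*-monoʳ-<-pos p {{ℚ.positive 0<p}} 0<q)

negated-product : ∀ p q → ℚ.- p ℚ.* ℚ.- q ≡ p ℚ.* q
negated-product = solve 2 (λ p q → :- p :* :- q := p :* q) refl

square≥0 : ∀ p → 0ℚ ℚ.≤ p ℚ.* p
square≥0 p with ℚₚ.≤-total 0ℚ p
... | inj₁ 0≤p = 0≤-* 0≤p 0≤p
... | inj₂ p≤0 = subst (0ℚ ℚ.≤_) (negated-product p p) (0≤-* (ℚₚ.neg-antimono-≤ p≤0) (ℚₚ.neg-antimono-≤ p≤0))

square>0 : ∀ p → p ≢ 0ℚ → 0ℚ ℚ.< p ℚ.* p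
square>0 p p≢0 with ℚₚ.<-cmp 0ℚ p
... | tri< 0<p _ _ = 0<-* 0<p 0<p
... | tri≈ _ 0≡p _ = ⊥-elim (p≢0 (sym 0≡p))
... | tri> _ _ p<0 = subst (0ℚ ℚ.<_) (negated-product p p) (0<-* (ℚₚ.neg-antimono-< p<0) (ℚₚ.neg-antimono-< p<0))

⟨x,x⟩≥0 : ∀ {d} (x : Point d) → 0ℚ ℚ.≤ ⟨ x , x ⟩
⟨x,x⟩≥0 [] = ℚₚ.≤-refl
⟨x,x⟩≥0 (x ∷ xs) = 0≤-+ (square≥0 x) (⟨x,x⟩≥0 xs)

⟨x,x⟩>0 : ∀ {d} (x : Point d) → x ≢ origin → 0ℚ ℚ.< ⟨ x , x ⟩
⟨x,x⟩>0 [] x≢0 = ⊥-elim (x≢0 refl)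
⟨x,x⟩>0 (x ∷ xs) x≢0 with x ℚₚ.≟ 0ℚ
... | yes refl = subst (0ℚ ℚ.<_) (sym (ℚₚ.+-identityˡ _)) (⟨x,x⟩>0 xs (x≢0 ∘ cong (0ℚ ∷_)))
... | no x≢0ℚ = ℚₚ.+-mono-<-≤ {0ℚ} {x ℚ.* x} {0ℚ} (square>0 x x≢0ℚ) (⟨x,x⟩≥0 xs)

comb-zero : ∀ {d} (a b : Point d) → (0ℚ ·ᵥ a) +ᵥ b ≡ b
comb-zero [] [] = refl
comb-zero (a ∷ as) (b ∷ bs) = cong₂ _∷_
  (solve 2 (λ a b → con 0ℚ :* a :+ b := b) refl a b) (comb-zero as bs)

comb-sheared : ∀ {d} s t (a c b : Point d) → c +ᵥ (s ·ᵥ a) ≡ b +ᵥ (t ·ᵥ a) → ((s ℚ.- t) ·ᵥ a) +ᵥ c ≡ b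
comb-sheared s t [] [] [] _ = refl
comb-sheared s t (a ∷ as) (c ∷ cs) (b ∷ bs) eq with ∷-injective eq
... | p , q = cong₂ _∷_ (trans
  (solve 4 (λ s t a c → (s :- t) :* a :+ c := (c :+ s :* a) :- t :* a) refl s t a c) (trans
  (cong (ℚ._- t ℚ.* a) p)
  (solve 3 (λ t a b → (b :+ t :* a) :- t :* a := b) refl t a b)))
  (comb-sheared s t as cs bs q)

shear-comb : ∀ {d} c s t (v u a : Point d) →
  (c ·ᵥ (v +ᵥ (s ·ᵥ a))) +ᵥ (u +ᵥ (t ·ᵥ a)) ≡ ((c ·ᵥ v) +ᵥ u) +ᵥ ((c ℚ.* s ℚ.+ t) ·ᵥ a)
shear-comb c s t [] [] [] = refl
shear-comb c s t (v ∷ vs) (u ∷ us) (a ∷ as) = cong₂ _∷_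
  (solve 6 (λ c s t v u a → c :* (v :+ s :* a) :+ (u :+ t :* a) := (c :* v :+ u) :+ (c :* s :+ t) :* a) refl c s t v u a)
  (shear-comb c s t vs us as)

origin-sheared : ∀ {d} (a : Point d) → origin ≡ origin +ᵥ (0ℚ ·ᵥ a)
origin-sheared [] = refl
origin-sheared (a ∷ as) = cong₂ _∷_ (sym (trans (ℚₚ.+-identityˡ _) (ℚₚ.*-zeroˡ a))) (origin-sheared as)

InCone : ∀ {d m} → Vec (Point d) m → Point d → Set
InCone {m = m} as b = Σ (Vec ℚ m) λ cs → All (0ℚ ℚ.≤_) cs × comb cs as ≡ b

Separated : ∀ {d m} → Vec (Point d) m → Point d → Set
Separated {d} as b = Σ (Point d) λ y → All (λ a → 0ℚ ℚ.≤ ⟨ y , a ⟩) as × ⟨ y , b ⟩ ℚ.< 0ℚ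

-- When ρ ⟨ y , a ⟩ = -1, project is the projection along a onto the hyperplane y = 0, and projectᵀ its adjoint.
module _ {d} (y a : Point d) (ρ : ℚ) where

  project : Point d → Point d
  project x = x +ᵥ ((ρ ℚ.* ⟨ y , x ⟩) ·ᵥ a)

  projectᵀ : Point d → Point d
  projectᵀ u = u +ᵥ ((ρ ℚ.* ⟨ u , a ⟩) ·ᵥ y)

  project-adjoint : ∀ u x → ⟨ projectᵀ u , x ⟩ ≡ ⟨ u , project x ⟩
  project-adjoint u x = begin
    ⟨ u +ᵥ ((ρ ℚ.* ⟨ u , a ⟩) ·ᵥ y) , x ⟩              ≡⟨ ⟨,⟩-+ˡ u _ x ⟩
    ⟨ u , x ⟩ ℚ.+ ⟨ (ρ ℚ.* ⟨ u , a ⟩) ·ᵥ y , x ⟩       ≡⟨ cong (⟨ u , x ⟩ ℚ.+_) (⟨,⟩-·ˡ (ρ ℚ.* ⟨ u , a ⟩) y x) ⟩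
    ⟨ u , x ⟩ ℚ.+ ρ ℚ.* ⟨ u , a ⟩ ℚ.* ⟨ y , x ⟩        ≡⟨ cong (⟨ u , x ⟩ ℚ.+_) (solve 3 (λ r p q → r :* p :* q := r :* q :* p) refl ρ ⟨ u , a ⟩ ⟨ y , x ⟩) ⟩
    ⟨ u , x ⟩ ℚ.+ ρ ℚ.* ⟨ y , x ⟩ ℚ.* ⟨ u , a ⟩        ≡⟨ cong (⟨ u , x ⟩ ℚ.+_) (⟨,⟩-·ʳ u (ρ ℚ.* ⟨ y , x ⟩) a) ⟨
    ⟨ u , x ⟩ ℚ.+ ⟨ u , (ρ ℚ.* ⟨ y , x ⟩) ·ᵥ a ⟩       ≡⟨ ⟨,⟩-+ʳ u x _ ⟨
    ⟨ u , project x ⟩                                  ∎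
    where open ≡-Reasoning

  comb-project : ∀ {m} cs (vs : Vec (Point d) m) →
    comb cs (map project vs) ≡ comb cs vs +ᵥ ((ρ ℚ.* weights cs vs y) ·ᵥ a)
  comb-project [] [] = trans (origin-sheared a) (cong (λ t → origin +ᵥ (t ·ᵥ a)) (sym (ℚₚ.*-zeroʳ ρ)))
  comb-project (c ∷ cs) (v ∷ vs) rewrite comb-project cs vs = trans
    (shear-comb c (ρ ℚ.* ⟨ y , v ⟩) (ρ ℚ.* weights cs vs y) v (comb cs vs) a)
    (cong (λ t → ((c ·ᵥ v) +ᵥ comb cs vs) +ᵥ (t ·ᵥ a))
      (solve 4 (λ c r p q → c :* (r :* p) :+ r :* q := r :* (c :* p :+ q)) refl c ρ ⟨ y , v ⟩ (weights cs vs y)))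

-- Induction on the generators. If `y` separates `b` from the old ones but is negative on `a`,
-- everything is projected along `a` onto the hyperplane of `y`. A separating functional there pulls
-- back to one that kills `a`; a cone combination lifts after adding a multiple of `a`.
farkas : ∀ {d m} (as : Vec (Point d) m) (b : Point d) → InCone as b ⊎ Separated as b
farkas [] b with ≡-dec ℚₚ._≟_ origin b
... | yes 0≡b = inj₁ ([] , [] , 0≡b)
-- The empty cone is the origin, and -b separates a nonzero b from it.
... | no 0≢b = inj₂ ((ℚ.- 1ℚ) ·ᵥ b , [] , subst (ℚ._< 0ℚ)
  (sym (trans (⟨,⟩-·ˡ (ℚ.- 1ℚ) b b) (solve 1 (λ p → (:- con 1ℚ) :* p := :- p) refl ⟨ b , b ⟩)))
  (ℚₚ.neg-antimono-< (⟨x,x⟩>0 b (0≢b ∘ sym))))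
farkas {d} (a ∷ as) b with farkas as b
... | inj₁ (cs , cs≥0 , eq) = inj₁ (0ℚ ∷ cs , ℚₚ.≤-refl ∷ cs≥0 , trans (comb-zero a _) eq)
... | inj₂ (y , y·as≥0 , y·b<0) with ℚₚ.<-cmp ⟨ y , a ⟩ 0ℚ
... | tri≈ _ y·a≡0 _ = inj₂ (y , ℚₚ.≤-reflexive (sym y·a≡0) ∷ y·as≥0 , y·b<0)
... | tri> _ _ y·a>0 = inj₂ (y , ℚₚ.<⇒≤ y·a>0 ∷ y·as≥0 , y·b<0)
... | tri< y·a<0 _ _ = extend (farkas (map (project y a ρ) as) (project y a ρ b))
  where
  instance
    negative-y·a : ℚ.Negative ⟨ y , a ⟩
    negative-y·a = ℚ.negative y·a<0
    nonZero-y·a : ℚ.NonZero ⟨ y , a ⟩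
    nonZero-y·a = ℚₚ.neg⇒nonZero ⟨ y , a ⟩
  ρ : ℚ
  ρ = ℚ.- (ℚ.1/ ⟨ y , a ⟩)
  ρ≥0 : 0ℚ ℚ.≤ ρ
  ρ≥0 = ℚₚ.<⇒≤ (ℚₚ.neg-antimono-< (ℚₚ.negative⁻¹ (ℚ.1/ ⟨ y , a ⟩) {{ℚₚ.1/neg⇒neg ⟨ y , a ⟩}}))
  ρ·y·a : ρ ℚ.* ⟨ y , a ⟩ ≡ ℚ.- 1ℚ
  ρ·y·a = trans (sym (ℚₚ.neg-distribˡ-* (ℚ.1/ ⟨ y , a ⟩) ⟨ y , a ⟩)) (cong ℚ.-_ (ℚₚ.*-inverseˡ ⟨ y , a ⟩))
  pullback : ∀ u {m} (vs : Vec (Point d) m) → All (λ v → 0ℚ ℚ.≤ ⟨ u , v ⟩) (map (project y a ρ) vs) →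
             All (λ v → 0ℚ ℚ.≤ ⟨ projectᵀ y a ρ u , v ⟩) vs
  pullback u [] [] = []
  pullback u (v ∷ vs) (p ∷ ps) = subst (0ℚ ℚ.≤_) (sym (project-adjoint y a ρ u v)) p ∷ pullback u vs ps
  projectᵀ-a : ∀ u → ⟨ projectᵀ y a ρ u , a ⟩ ≡ 0ℚ
  projectᵀ-a u = begin
    ⟨ projectᵀ y a ρ u , a ⟩                          ≡⟨ ⟨,⟩-+ˡ u _ a ⟩
    ⟨ u , a ⟩ ℚ.+ ⟨ (ρ ℚ.* ⟨ u , a ⟩) ·ᵥ y , a ⟩      ≡⟨ cong (⟨ u , a ⟩ ℚ.+_) (⟨,⟩-·ˡ (ρ ℚ.* ⟨ u , a ⟩) y a) ⟩
    ⟨ u , a ⟩ ℚ.+ ρ ℚ.* ⟨ u , a ⟩ ℚ.* ⟨ y , a ⟩       ≡⟨ solve 3 (λ r p q → p :+ r :* p :* q := p :+ r :* q :* p) refl ρ ⟨ u , a ⟩ ⟨ y , a ⟩ ⟩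
    ⟨ u , a ⟩ ℚ.+ ρ ℚ.* ⟨ y , a ⟩ ℚ.* ⟨ u , a ⟩       ≡⟨ cong (λ t → ⟨ u , a ⟩ ℚ.+ t ℚ.* ⟨ u , a ⟩) ρ·y·a ⟩
    ⟨ u , a ⟩ ℚ.+ (ℚ.- 1ℚ) ℚ.* ⟨ u , a ⟩              ≡⟨ solve 1 (λ p → p :+ (:- con 1ℚ) :* p := con 0ℚ) refl ⟨ u , a ⟩ ⟩
    0ℚ                                                ∎
    where open ≡-Reasoning
  extend : InCone (map (project y a ρ) as) (project y a ρ b) ⊎ Separated (map (project y a ρ) as) (project y a ρ b) →
           InCone (a ∷ as) b ⊎ Separated (a ∷ as) b
  extend (inj₂ (u , u·as≥0 , u·b<0)) = inj₂ (projectᵀ y a ρ u ,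
    ℚₚ.≤-reflexive (sym (projectᵀ-a u)) ∷ pullback u as u·as≥0 ,
    subst (ℚ._< 0ℚ) (sym (project-adjoint y a ρ u b)) u·b<0)
  extend (inj₁ (cs , cs≥0 , eq)) = inj₁ (c ∷ cs , c≥0 ∷ cs≥0 ,
    comb-sheared (ρ ℚ.* weights cs as y) (ρ ℚ.* ⟨ y , b ⟩) a (comb cs as) b (trans (sym (comb-project y a ρ cs as)) eq))
    where
    -- The coefficient of `a` undoing both projections; it is nonnegative since `y` is nonnegative
    -- on `as` and negative on `b`.
    c = ρ ℚ.* weights cs as y ℚ.- ρ ℚ.* ⟨ y , b ⟩
    c≥0 : 0ℚ ℚ.≤ c
    c≥0 = 0≤-+ (0≤-* ρ≥0 (weights-≥0 cs≥0 y·as≥0))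
      (subst (0ℚ ℚ.≤_) (sym (ℚₚ.neg-distribʳ-* ρ ⟨ y , b ⟩)) (0≤-* ρ≥0 (ℚₚ.neg-antimono-≤ (ℚₚ.<⇒≤ y·b<0))))

-- Lattice points of dilates as solutions of integral inequalities

-- Arithmetic of `toℚ` is checked on unnormalised fractions, where it is integer arithmetic without
-- reduction by a gcd.
toℚᵘ-toℚ : ∀ i → ℚ.toℚᵘ (toℚ i) ℚᵘ.≃ mkℚᵘ i 0
toℚᵘ-toℚ i = ℚₚ.toℚᵘ-fromℚᵘ (mkℚᵘ i 0)

toℚ-+ : ∀ i j → toℚ (i ℤ.+ j) ≡ toℚ i ℚ.+ toℚ j
toℚ-+ i j = ℚₚ.toℚᵘ-injective (begin
  ℚ.toℚᵘ (toℚ (i ℤ.+ j))                  ≈⟨ toℚᵘ-toℚ (i ℤ.+ j) ⟩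
  mkℚᵘ (i ℤ.+ j) 0                        ≈⟨ *≡* (lemma i j) ⟩
  mkℚᵘ i 0 ℚᵘ.+ mkℚᵘ j 0                  ≈⟨ ℚᵘₚ.+-cong (toℚᵘ-toℚ i) (toℚᵘ-toℚ j) ⟨
  ℚ.toℚᵘ (toℚ i) ℚᵘ.+ ℚ.toℚᵘ (toℚ j)      ≈⟨ ℚₚ.toℚᵘ-homo-+ (toℚ i) (toℚ j) ⟨
  ℚ.toℚᵘ (toℚ i ℚ.+ toℚ j)                ∎)
  where
  open ℚᵘₚ.≃-Reasoning
  lemma : ∀ i j → (i ℤ.+ j) ℤ.* 1ℤ ≡ (i ℤ.* 1ℤ ℤ.+ j ℤ.* 1ℤ) ℤ.* 1ℤ
  lemma = solve-∀

toℚ-* : ∀ i j → toℚ (i ℤ.* j) ≡ toℚ i ℚ.* toℚ j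
toℚ-* i j = ℚₚ.toℚᵘ-injective (begin
  ℚ.toℚᵘ (toℚ (i ℤ.* j))                  ≈⟨ toℚᵘ-toℚ (i ℤ.* j) ⟩
  mkℚᵘ (i ℤ.* j) 0                        ≈⟨ *≡* refl ⟩
  mkℚᵘ i 0 ℚᵘ.* mkℚᵘ j 0                  ≈⟨ ℚᵘₚ.*-cong (toℚᵘ-toℚ i) (toℚᵘ-toℚ j) ⟨
  ℚ.toℚᵘ (toℚ i) ℚᵘ.* ℚ.toℚᵘ (toℚ j)      ≈⟨ ℚₚ.toℚᵘ-homo-* (toℚ i) (toℚ j) ⟨
  ℚ.toℚᵘ (toℚ i ℚ.* toℚ j)                ∎)
  where
  open ℚᵘₚ.≃-Reasoning

toℚ-mono-≤ : ∀ {i j} → i ℤ.≤ j → toℚ i ℚ.≤ toℚ j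
toℚ-mono-≤ {i} {j} i≤j = ℚₚ.toℚᵘ-cancel-≤ (ℚᵘₚ.≤-respʳ-≃ (ℚᵘₚ.≃-sym (toℚᵘ-toℚ j))
  (ℚᵘₚ.≤-respˡ-≃ (ℚᵘₚ.≃-sym (toℚᵘ-toℚ i)) (*≤* (ℤₚ.*-monoʳ-≤-nonNeg 1ℤ i≤j))))

0≤toℚ : ∀ j → 0ℚ ℚ.≤ toℚ (+ j)
0≤toℚ j = toℚ-mono-≤ {0ℤ} {+ j} (ℤ.+≤+ z≤n)

toℚ-cancel-≤ : ∀ {i j} → toℚ i ℚ.≤ toℚ j → i ℤ.≤ j
toℚ-cancel-≤ {i} {j} i≤j = ℤₚ.*-cancelʳ-≤-pos i j 1ℤ (ℚᵘₚ.drop-*≤*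
  (ℚᵘₚ.≤-respʳ-≃ (toℚᵘ-toℚ j) (ℚᵘₚ.≤-respˡ-≃ (toℚᵘ-toℚ i) (ℚₚ.toℚᵘ-mono-≤ i≤j))))

⟨,⟩-intPt : ∀ {d} (u z : IntPoint d) → ⟨ intPt u , intPt z ⟩ ≡ toℚ (u ∙ z)
⟨,⟩-intPt [] [] = refl
⟨,⟩-intPt (u ∷ us) (z ∷ zs) = sym (trans (toℚ-+ (u ℤ.* z) (us ∙ zs))
  (cong₂ ℚ._+_ (toℚ-* u z) (sym (⟨,⟩-intPt us zs))))

·ᵥ-distrib : ∀ {d} t c (v w : Point d) → (c ·ᵥ (t ·ᵥ v)) +ᵥ (t ·ᵥ w) ≡ t ·ᵥ ((c ·ᵥ v) +ᵥ w)
·ᵥ-distrib t c [] [] = refl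
·ᵥ-distrib t c (v ∷ vs) (w ∷ ws) = cong₂ _∷_
  (solve 4 (λ t c v w → c :* (t :* v) :+ t :* w := t :* (c :* v :+ w)) refl t c v w) (·ᵥ-distrib t c vs ws)

·ᵥ-origin : ∀ {d} t → t ·ᵥ origin {d} ≡ origin
·ᵥ-origin {zero} t = refl
·ᵥ-origin {suc d} t = cong₂ _∷_ (ℚₚ.*-zeroʳ t) (·ᵥ-origin t)

comb-scaled : ∀ {d m} t cs (vs : Vec (Point d) m) → comb cs (map (t ·ᵥ_) vs) ≡ t ·ᵥ comb cs vs
comb-scaled t [] [] = sym (·ᵥ-origin t)
comb-scaled t (c ∷ cs) (v ∷ vs) rewrite comb-scaled t cs vs = ·ᵥ-distrib t c v (comb cs vs)

·ᵥ-rescale : ∀ {d} s t → s ℚ.* t ≡ 1ℚ → ∀ c (v w : Point d) →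
  ((s ℚ.* c) ·ᵥ (t ·ᵥ v)) +ᵥ w ≡ (c ·ᵥ v) +ᵥ w
·ᵥ-rescale s t st≡1 c [] [] = refl
·ᵥ-rescale s t st≡1 c (v ∷ vs) (w ∷ ws) = cong₂ _∷_ (cong (ℚ._+ w) (trans
  (solve 4 (λ s t c v → s :* c :* (t :* v) := s :* t :* (c :* v)) refl s t c v)
  (trans (cong (ℚ._* (c ℚ.* v)) st≡1) (ℚₚ.*-identityˡ (c ℚ.* v))))) (·ᵥ-rescale s t st≡1 c vs ws)

comb-rescale : ∀ {d m} s t → s ℚ.* t ≡ 1ℚ → ∀ cs (vs : Vec (Point d) m) →
  comb (map (s ℚ.*_) cs) (map (t ·ᵥ_) vs) ≡ comb cs vs
comb-rescale s t st≡1 [] [] = refl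
comb-rescale s t st≡1 (c ∷ cs) (v ∷ vs) rewrite comb-rescale s t st≡1 cs vs =
  ·ᵥ-rescale s t st≡1 c v (comb cs vs)

sumℚ-scaled : ∀ {m} s (cs : Vec ℚ m) → sumℚ (map (s ℚ.*_) cs) ≡ s ℚ.* sumℚ cs
sumℚ-scaled s [] = sym (ℚₚ.*-zeroʳ s)
sumℚ-scaled s (c ∷ cs) = trans (cong (λ p → s ℚ.* c ℚ.+ p) (sumℚ-scaled s cs)) (sym (ℚₚ.*-distribˡ-+ s c (sumℚ cs)))

sumℚ-≥0 : ∀ {m} {cs : Vec ℚ m} → All (0ℚ ℚ.≤_) cs → 0ℚ ℚ.≤ sumℚ cs
sumℚ-≥0 [] = ℚₚ.≤-refl
sumℚ-≥0 (p ∷ ps) = 0≤-+ p (sumℚ-≥0 ps)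

sumℚ≡0 : ∀ {m} {cs : Vec ℚ m} → All (0ℚ ℚ.≤_) cs → sumℚ cs ≡ 0ℚ → All (_≡ 0ℚ) cs
sumℚ≡0 [] _ = []
sumℚ≡0 {cs = c ∷ cs} (p ∷ ps) eq = c≡0 ∷ sumℚ≡0 ps
  (trans (sym (ℚₚ.+-identityˡ _)) (trans (cong (ℚ._+ sumℚ cs) (sym c≡0)) eq))
  where
  c≡0 : c ≡ 0ℚ
  c≡0 = ℚₚ.≤-antisym (subst₂ ℚ._≤_ (ℚₚ.+-identityʳ c) eq (ℚₚ.+-monoʳ-≤ c (sumℚ-≥0 ps))) p

comb-zeros : ∀ {d m} {cs : Vec ℚ m} → All (_≡ 0ℚ) cs → (vs : Vec (Point d) m) → comb cs vs ≡ origin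
comb-zeros [] [] = refl
comb-zeros (refl ∷ ps) (v ∷ vs) = trans (comb-zero v _) (comb-zeros ps vs)

-- With the points placed at height 1, the sum of the coefficients becomes a coordinate, so that
-- Farkas' lemma for cones applies to convex hulls.
comb-homogenise : ∀ {d m} cs (vs : Vec (Point d) m) → comb cs (map (1ℚ ∷_) vs) ≡ sumℚ cs ∷ comb cs vs
comb-homogenise [] [] = refl
comb-homogenise (c ∷ cs) (v ∷ vs) rewrite comb-homogenise cs vs =
  cong (_∷ ((c ·ᵥ v) +ᵥ comb cs vs)) (cong (ℚ._+ sumℚ cs) (ℚₚ.*-identityʳ c))

convex-bound : ∀ {d m} {vs : Vec (Point d) m} {x} y t → All (λ v → ⟨ y , v ⟩ ℚ.≤ t) vs → InConv vs x → ⟨ y , x ⟩ ℚ.≤ t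
convex-bound {vs = vs} y t bounds (cs , cs≥0 , sum≡1 , refl) = begin
  ⟨ y , comb cs vs ⟩      ≡⟨ ⟨,⟩-comb y cs vs ⟩
  weights cs vs y         ≤⟨ weights-≤ cs≥0 bounds ⟩
  t ℚ.* sumℚ cs           ≡⟨ cong (t ℚ.*_) sum≡1 ⟩
  t ℚ.* 1ℚ                ≡⟨ ℚₚ.*-identityʳ t ⟩
  t                       ∎
  where
  open ℚₚ.≤-Reasoning
  weights-≤ : ∀ {m} {cs : Vec ℚ m} {vs} → All (0ℚ ℚ.≤_) cs → All (λ v → ⟨ y , v ⟩ ℚ.≤ t) vs → weights cs vs y ℚ.≤ t ℚ.* sumℚ cs
  weights-≤ [] [] = ℚₚ.≤-reflexive (sym (ℚₚ.*-zeroʳ t))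
  weights-≤ {cs = c ∷ cs} (p ∷ ps) (q ∷ qs) = ℚₚ.≤-trans
    (ℚₚ.+-mono-≤ (ℚₚ.*-monoˡ-≤-nonNeg c {{ℚ.nonNegative p}} q) (weights-≤ ps qs))
    (ℚₚ.≤-reflexive (solve 3 (λ c t s → c :* t :+ t :* s := t :* (c :+ s)) refl c t (sumℚ cs)))

vertex : ∀ {d m} (vs : Vec (Point d) m) → All (InConv vs) vs
vertex {d} [] = []
vertex {d} {suc m} (v ∷ vs) =
  (1ℚ ∷ replicate m 0ℚ , ℚₚ.nonNegative⁻¹ 1ℚ ∷ nonneg m , trans (cong (1ℚ ℚ.+_) (sum m)) refl ,
    trans (cong ((1ℚ ·ᵥ v) +ᵥ_) (comb-zeros (zeros m) vs)) (unit v)) ∷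
  All.map (λ { (cs , cs≥0 , sum≡1 , eq) → 0ℚ ∷ cs , ℚₚ.≤-refl ∷ cs≥0 , trans (ℚₚ.+-identityˡ _) sum≡1 , trans (comb-zero v _) eq }) (vertex vs)
  where
  nonneg : ∀ m → All (0ℚ ℚ.≤_) (replicate m 0ℚ)
  nonneg zero = []
  nonneg (suc m) = ℚₚ.≤-refl ∷ nonneg m
  zeros : ∀ m → All (_≡ 0ℚ) (replicate m 0ℚ)
  zeros zero = []
  zeros (suc m) = refl ∷ zeros m
  sum : ∀ m → sumℚ (replicate m 0ℚ) ≡ 0ℚ
  sum zero = refl
  sum (suc m) = trans (ℚₚ.+-identityˡ _) (sum m)
  unit : ∀ {d} (v : Point d) → (1ℚ ·ᵥ v) +ᵥ origin ≡ v
  unit [] = refl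
  unit (v ∷ vs) = cong₂ _∷_ (solve 1 (λ v → con 1ℚ :* v :+ con 0ℚ := v) refl v) (unit vs)

module _ {n m p} (vs : Vec (Point n) m) (ws : Vec (IntPoint n) p)
  (0∈P : InConv vs origin)
  (dual⊆ : ∀ u → InDual vs u → InConv (map intPt ws) u)
  (⊆dual : ∀ u → InConv (map intPt ws) u → InDual vs u) where

  dilate⇒inequalities : ∀ j z → InConv (dilate j vs) (intPt z) → All (λ u → u ∙ z ℤ.≤ + j) ws
  dilate⇒inequalities j z (cs , cs≥0 , sum≡1 , eq) =
    All.map (λ {u} → bound u) (Allₚ.map⁻ (vertex (map intPt ws)))
    where
    bound : ∀ u → InConv (map intPt ws) (intPt u) → u ∙ z ℤ.≤ + j
    bound u u∈ = toℚ-cancel-≤ (begin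
      toℚ (u ∙ z)                                  ≡⟨ sym (⟨,⟩-intPt u z) ⟩
      ⟨ intPt u , intPt z ⟩                        ≡⟨ cong (λ v → ⟨ intPt u , v ⟩) (trans (sym eq) (comb-scaled (toℚ (+ j)) cs vs)) ⟩
      ⟨ intPt u , toℚ (+ j) ·ᵥ comb cs vs ⟩        ≡⟨ ⟨,⟩-·ʳ (intPt u) (toℚ (+ j)) (comb cs vs) ⟩
      toℚ (+ j) ℚ.* ⟨ intPt u , comb cs vs ⟩       ≤⟨ ℚₚ.*-monoˡ-≤-nonNeg (toℚ (+ j)) {{ℚ.nonNegative (0≤toℚ j)}}
                                                      (⊆dual (intPt u) u∈ (comb cs vs) (cs , cs≥0 , sum≡1 , refl)) ⟩
      toℚ (+ j) ℚ.* 1ℚ                             ≡⟨ ℚₚ.*-identityʳ _ ⟩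
      toℚ (+ j)                                    ∎)
      where open ℚₚ.≤-Reasoning

  -- For j > 0 the coefficients are divided by j. At height 0 they are nonnegative with sum 0, so x
  -- is the origin, which lies in 0P because P contains a point.
  cone⇒dilate : ∀ j x → InCone (map (1ℚ ∷_) vs) (toℚ (+ j) ∷ x) → InConv (dilate j vs) x
  cone⇒dilate j x (cs , cs≥0 , eq) with ∷-injective (trans (sym (comb-homogenise cs vs)) eq)
  cone⇒dilate zero x (cs , cs≥0 , _) | sum≡0 , comb≡x = let (cs₀ , cs₀≥0 , sum≡1 , comb≡0) = 0∈P in
    cs₀ , cs₀≥0 , sum≡1 , trans (comb-scaled 0ℚ cs₀ vs)
      (trans (cong (0ℚ ·ᵥ_) comb≡0) (trans (·ᵥ-origin 0ℚ) (trans (sym (comb-zeros (sumℚ≡0 cs≥0 sum≡0) vs)) comb≡x)))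
  cone⇒dilate (suc j) x (cs , cs≥0 , _) | sum≡j , comb≡x =
    map (jℚ⁻¹ ℚ.*_) cs , Allₚ.map⁺ (All.map (0≤-* jℚ⁻¹≥0) cs≥0) ,
    trans (sumℚ-scaled jℚ⁻¹ cs) (trans (cong (jℚ⁻¹ ℚ.*_) sum≡j) (ℚₚ.*-inverseˡ jℚ)) ,
    trans (comb-rescale jℚ⁻¹ jℚ (ℚₚ.*-inverseˡ jℚ) cs vs) comb≡x
    where
    jℚ = toℚ (+ suc j)
    instance
      positive-jℚ : ℚ.Positive jℚ
      positive-jℚ = ℚₚ.normalize-pos (suc j) 1
      nonZero-jℚ : ℚ.NonZero jℚ
      nonZero-jℚ = ℚₚ.pos⇒nonZero jℚ
    jℚ⁻¹ = ℚ.1/ jℚ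
    jℚ⁻¹≥0 : 0ℚ ℚ.≤ jℚ⁻¹
    jℚ⁻¹≥0 = ℚₚ.<⇒≤ (ℚₚ.positive⁻¹ jℚ⁻¹ {{ℚₚ.1/pos⇒pos jℚ}})

  -- y / β lies in the dual, hence in the hull of `ws`, and the bound by j passes from `ws` to their
  -- convex combinations.
  dual-bound : ∀ j z → All (λ u → u ∙ z ℤ.≤ + j) ws → ∀ β y → 0ℚ ℚ.< β →
    (∀ v → InConv vs v → ⟨ y , v ⟩ ℚ.≤ β) → ⟨ y , intPt z ⟩ ℚ.≤ β ℚ.* toℚ (+ j)
  dual-bound j z ineqs β y β>0 bounded = begin
    ⟨ y , intPt z ⟩                         ≡⟨ ℚₚ.*-identityˡ _ ⟨
    1ℚ ℚ.* ⟨ y , intPt z ⟩                  ≡⟨ cong (ℚ._* ⟨ y , intPt z ⟩) (ℚₚ.*-inverseʳ β) ⟨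
    β ℚ.* ℚ.1/ β ℚ.* ⟨ y , intPt z ⟩        ≡⟨ ℚₚ.*-assoc β (ℚ.1/ β) _ ⟩
    β ℚ.* (ℚ.1/ β ℚ.* ⟨ y , intPt z ⟩)      ≡⟨ cong (β ℚ.*_) (⟨,⟩-·ˡ (ℚ.1/ β) y (intPt z)) ⟨
    β ℚ.* ⟨ (ℚ.1/ β) ·ᵥ y , intPt z ⟩         ≤⟨ ℚₚ.*-monoˡ-≤-nonNeg β {{ℚₚ.pos⇒nonNeg β}} y/β·z≤j ⟩
    β ℚ.* toℚ (+ j)                         ∎
    where
    open ℚₚ.≤-Reasoning
    instance
      positive-β : ℚ.Positive β
      positive-β = ℚ.positive β>0
      nonZero-β : ℚ.NonZero β
      nonZero-β = ℚₚ.pos⇒nonZero β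
    y/β∈dual : InDual vs ((ℚ.1/ β) ·ᵥ y)
    y/β∈dual v v∈P = begin
      ⟨ (ℚ.1/ β) ·ᵥ y , v ⟩      ≡⟨ ⟨,⟩-·ˡ (ℚ.1/ β) y v ⟩
      ℚ.1/ β ℚ.* ⟨ y , v ⟩     ≤⟨ ℚₚ.*-monoˡ-≤-nonNeg (ℚ.1/ β) {{ℚₚ.pos⇒nonNeg (ℚ.1/ β) {{ℚₚ.1/pos⇒pos β}}}} (bounded v v∈P) ⟩
      ℚ.1/ β ℚ.* β             ≡⟨ ℚₚ.*-inverseˡ β ⟩
      1ℚ                       ∎
    y/β·z≤j : ⟨ (ℚ.1/ β) ·ᵥ y , intPt z ⟩ ℚ.≤ toℚ (+ j)
    y/β·z≤j = subst (ℚ._≤ toℚ (+ j)) (⟨,⟩-comm (intPt z) ((ℚ.1/ β) ·ᵥ y))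
      (convex-bound (intPt z) (toℚ (+ j)) (Allₚ.map⁺ (All.map (λ {u} u·z≤j →
        subst (ℚ._≤ toℚ (+ j)) (trans (sym (⟨,⟩-intPt u z)) (⟨,⟩-comm (intPt u) (intPt z))) (toℚ-mono-≤ u·z≤j)) ineqs))
        (dual⊆ ((ℚ.1/ β) ·ᵥ y) y/β∈dual))

  -- Otherwise Farkas' lemma gives (β, y) nonnegative on P at height 1 and negative at (j, z). Then
  -- -y is at most β on P, and for β > 0 `dual-bound` contradicts the negativity. As β may be 0, the
  -- functional is perturbed first.
  inequalities⇒dilate : ∀ j z → All (λ u → u ∙ z ℤ.≤ + j) ws → InConv (dilate j vs) (intPt z)
  inequalities⇒dilate j z ineqs with farkas (map (1ℚ ∷_) vs) (toℚ (+ j) ∷ intPt z)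
  ... | inj₁ cone = cone⇒dilate j (intPt z) cone
  ... | inj₂ (β ∷ y , nonneg , neg) = ⊥-elim (ℚₚ.<-irrefl refl (ℚₚ.<-≤-trans g>0 g≤0))
    where
    jℚ = toℚ (+ j)
    jℚ≥0 : 0ℚ ℚ.≤ jℚ
    jℚ≥0 = 0≤toℚ j
    jℚ+1≥0 : 0ℚ ℚ.≤ jℚ ℚ.+ 1ℚ
    jℚ+1≥0 = 0≤-+ jℚ≥0 (ℚₚ.nonNegative⁻¹ 1ℚ)
    x = intPt z
    g = ℚ.- (β ℚ.* jℚ ℚ.+ ⟨ y , x ⟩)
    g>0 : 0ℚ ℚ.< g
    g>0 = ℚₚ.neg-antimono-< neg
    below : ∀ v → InConv vs v → ℚ.- ⟨ y , v ⟩ ℚ.≤ β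
    below v v∈P = subst (ℚ._≤ β) (⟨-y,⟩ v)
      (convex-bound ((ℚ.- 1ℚ) ·ᵥ y) β (All.map (λ {v} → vertex-bound v) (Allₚ.map⁻ nonneg)) v∈P)
      where
      ⟨-y,⟩ : ∀ v → ⟨ (ℚ.- 1ℚ) ·ᵥ y , v ⟩ ≡ ℚ.- ⟨ y , v ⟩
      ⟨-y,⟩ v = trans (⟨,⟩-·ˡ (ℚ.- 1ℚ) y v) (solve 1 (λ t → (:- con 1ℚ) :* t := :- t) refl ⟨ y , v ⟩)
      vertex-bound : ∀ v → 0ℚ ℚ.≤ β ℚ.* 1ℚ ℚ.+ ⟨ y , v ⟩ → ⟨ (ℚ.- 1ℚ) ·ᵥ y , v ⟩ ℚ.≤ β
      vertex-bound v 0≤ = subst₂ ℚ._≤_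
        (trans (ℚₚ.+-identityˡ _) (sym (⟨-y,⟩ v)))
        (solve 2 (λ β t → β :* con 1ℚ :+ t :+ (:- t) := β) refl β ⟨ y , v ⟩)
        (ℚₚ.+-monoˡ-≤ (ℚ.- ⟨ y , v ⟩) 0≤)
    β≥0 : 0ℚ ℚ.≤ β
    β≥0 = subst (ℚ._≤ β) (cong ℚ.-_ (⟨,⟩-origin y)) (below origin 0∈P)
    -- Adding the gap `g` makes the bound positive, and the factor j + 1 outweighs it: `dual-bound`
    -- then reads (j + 1) g ≤ j g, that is g ≤ 0.
    β′ = g ℚ.+ (jℚ ℚ.+ 1ℚ) ℚ.* β
    y′ = (ℚ.- (jℚ ℚ.+ 1ℚ)) ·ᵥ y
    ⟨y′,⟩ : ∀ v → ⟨ y′ , v ⟩ ≡ (jℚ ℚ.+ 1ℚ) ℚ.* ℚ.- ⟨ y , v ⟩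
    ⟨y′,⟩ v = trans (⟨,⟩-·ˡ (ℚ.- (jℚ ℚ.+ 1ℚ)) y v)
      (solve 2 (λ s t → (:- s) :* t := s :* :- t) refl (jℚ ℚ.+ 1ℚ) ⟨ y , v ⟩)
    β′>0 : 0ℚ ℚ.< β′
    β′>0 = ℚₚ.+-mono-<-≤ {0ℚ} {g} {0ℚ} g>0 (0≤-* jℚ+1≥0 β≥0)
    bounded : ∀ v → InConv vs v → ⟨ y′ , v ⟩ ℚ.≤ β′
    bounded v v∈P = begin
      ⟨ y′ , v ⟩                            ≡⟨ ⟨y′,⟩ v ⟩
      (jℚ ℚ.+ 1ℚ) ℚ.* ℚ.- ⟨ y , v ⟩          ≤⟨ ℚₚ.*-monoˡ-≤-nonNeg (jℚ ℚ.+ 1ℚ) {{ℚ.nonNegative jℚ+1≥0}} (below v v∈P) ⟩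
      (jℚ ℚ.+ 1ℚ) ℚ.* β                      ≡⟨ ℚₚ.+-identityˡ _ ⟨
      0ℚ ℚ.+ (jℚ ℚ.+ 1ℚ) ℚ.* β               ≤⟨ ℚₚ.+-monoˡ-≤ ((jℚ ℚ.+ 1ℚ) ℚ.* β) (ℚₚ.<⇒≤ g>0) ⟩
      β′                                    ∎
      where open ℚₚ.≤-Reasoning
    g≤0 : g ℚ.≤ 0ℚ
    g≤0 = subst₂ ℚ._≤_
      (trans (cong (ℚ._+ ℚ.- (β′ ℚ.* jℚ)) (⟨y′,⟩ x))
        (solve 3 (λ jℚ β t → (jℚ :+ con 1ℚ) :* (:- t) :- (:- (β :* jℚ :+ t) :+ (jℚ :+ con 1ℚ) :* β) :* jℚ := :- (β :* jℚ :+ t)) refl jℚ β ⟨ y , x ⟩))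
      (ℚₚ.+-inverseʳ (β′ ℚ.* jℚ))
      (ℚₚ.+-monoˡ-≤ (ℚ.- (β′ ℚ.* jℚ)) (dual-bound j z ineqs β′ y′ β′>0 bounded))

-- Power series and sequences on ℤ

∇ℕ : (ℕ → ℤ) → ℕ → ℤ
∇ℕ g zero    = g zero
∇ℕ g (suc m) = g (suc m) ℤ.- g m

sumTo-cong : ∀ m {f g} → (∀ j → f j ≡ g j) → sumTo m f ≡ sumTo m g
sumTo-cong zero eq = eq 0
sumTo-cong (suc m) eq = cong₂ ℤ._+_ (sumTo-cong m eq) (eq (suc m))

sumTo-head : ∀ m f → sumTo (suc m) f ≡ f 0 ℤ.+ sumTo m (f ∘ suc)
sumTo-head zero f = refl
sumTo-head (suc m) f = trans (cong (ℤ._+ f (suc (suc m))) (sumTo-head m f)) (ℤₚ.+-assoc (f 0) _ _)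

sumTo-zero : ∀ m {f} → (∀ j → f j ≡ 0ℤ) → sumTo m f ≡ 0ℤ
sumTo-zero zero eq = eq 0
sumTo-zero (suc m) eq = cong₂ ℤ._+_ (sumTo-zero m eq) (eq (suc m))

sumTo-- : ∀ m f g → sumTo m (λ j → f j ℤ.- g j) ≡ sumTo m f ℤ.- sumTo m g
sumTo-- zero f g = refl
sumTo-- (suc m) f g rewrite sumTo-- m f g = lemma (sumTo m f) (sumTo m g) (f (suc m)) (g (suc m))
  where
  lemma : ∀ a b c d → (a ℤ.- b) ℤ.+ (c ℤ.- d) ≡ (a ℤ.+ c) ℤ.- (b ℤ.+ d)
  lemma = solve-∀

⊛-congˡ : ∀ {p q} g → (∀ j → p j ≡ q j) → ∀ m → (p ⊛ g) m ≡ (q ⊛ g) m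
⊛-congˡ g eq m = sumTo-cong m λ j → cong (ℤ._* g (m ∸ j)) (eq j)

onePS-⊛ : ∀ g m → (onePS ⊛ g) m ≡ g m
onePS-⊛ g zero = ℤₚ.*-identityˡ (g 0)
onePS-⊛ g (suc m) = trans (sumTo-head m _) (trans
  (cong₂ ℤ._+_ (ℤₚ.*-identityˡ (g (suc m))) (sumTo-zero m λ j → ℤₚ.*-zeroˡ (g (m ∸ j))))
  (ℤₚ.+-identityʳ _))

oneMinusT-⊛ : ∀ p m → (oneMinusT ⊛ p) m ≡ ∇ℕ p m
oneMinusT-⊛ p zero = ℤₚ.*-identityˡ (p 0)
oneMinusT-⊛ p (suc zero) = cong₂ ℤ._+_ (ℤₚ.*-identityˡ (p 1)) (ℤₚ.-1*i≡-i (p 0))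
oneMinusT-⊛ p (suc (suc m)) = trans (sumTo-head (suc m) _) (cong₂ ℤ._+_ (ℤₚ.*-identityˡ (p (suc (suc m))))
  (trans (sumTo-head m _) (trans
    (cong₂ ℤ._+_ (ℤₚ.-1*i≡-i (p (suc m))) (sumTo-zero m λ j → ℤₚ.*-zeroˡ (p (m ∸ j))))
    (ℤₚ.+-identityʳ _))))

-- The instance ((1 - t) p) g = (1 - t) (p g) of associativity, through which powers of 1 - t become
-- iterated differences.
∇ℕ-⊛ : ∀ p g m → (∇ℕ p ⊛ g) m ≡ ∇ℕ (p ⊛ g) m
∇ℕ-⊛ p g zero = refl
∇ℕ-⊛ p g (suc m) = begin
  (∇ℕ p ⊛ g) (suc m)
    ≡⟨ sumTo-head m _ ⟩
  p 0 ℤ.* g (suc m) ℤ.+ sumTo m (λ j → (p (suc j) ℤ.- p j) ℤ.* g (m ∸ j))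
    ≡⟨ cong (λ s → p 0 ℤ.* g (suc m) ℤ.+ s) (trans
         (sumTo-cong m λ j → distrib (p (suc j)) (p j) (g (m ∸ j)))
         (sumTo-- m (λ j → p (suc j) ℤ.* g (m ∸ j)) (λ j → p j ℤ.* g (m ∸ j)))) ⟩
  p 0 ℤ.* g (suc m) ℤ.+ (sumTo m (λ j → p (suc j) ℤ.* g (m ∸ j)) ℤ.- (p ⊛ g) m)
    ≡⟨ ℤₚ.+-assoc (p 0 ℤ.* g (suc m)) _ _ ⟨
  p 0 ℤ.* g (suc m) ℤ.+ sumTo m (λ j → p (suc j) ℤ.* g (m ∸ j)) ℤ.- (p ⊛ g) m
    ≡⟨ cong (ℤ._- (p ⊛ g) m) (sumTo-head m (λ j → p j ℤ.* g (suc m ∸ j))) ⟨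
  (p ⊛ g) (suc m) ℤ.- (p ⊛ g) m
    ∎
  where
  open ≡-Reasoning
  distrib : ∀ a b c → (a ℤ.- b) ℤ.* c ≡ a ℤ.* c ℤ.- b ℤ.* c
  distrib = solve-∀

-- Extension by 0 absorbs the boundary case of `∇ℕ` into the plain backward difference on ℤ.
extend : (ℕ → ℤ) → ℤ → ℤ
extend g (+ n)    = g n
extend g -[1+ _ ] = 0ℤ

extend-cong : ∀ {f g} → (∀ n → f n ≡ g n) → ∀ l → extend f l ≡ extend g l
extend-cong eq (+ n) = eq n
extend-cong eq -[1+ _ ] = refl

∇ : (ℤ → ℤ) → ℤ → ℤ
∇ g l = g l ℤ.- g (ℤ.pred l)

∇^ : ℕ → (ℤ → ℤ) → ℤ → ℤ
∇^ zero    g = g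
∇^ (suc N) g = ∇ (∇^ N g)

∇-cong : ∀ {f g} → (∀ l → f l ≡ g l) → ∀ l → ∇ f l ≡ ∇ g l
∇-cong eq l = cong₂ ℤ._-_ (eq l) (eq (ℤ.pred l))

∇-extend : ∀ g l → ∇ (extend g) l ≡ extend (∇ℕ g) l
∇-extend g (+ zero) = ℤₚ.+-identityʳ (g 0)
∇-extend g (+ suc n) = refl
∇-extend g -[1+ n ] = refl

∇^-extend : ∀ N g l → ∇^ N (extend g) l ≡ extend (powPS oneMinusT N ⊛ g) l
∇^-extend zero g = extend-cong λ n → sym (onePS-⊛ g n)
∇^-extend (suc N) g l = begin
  ∇ (∇^ N (extend g)) l                          ≡⟨ ∇-cong (∇^-extend N g) l ⟩
  ∇ (extend (powPS oneMinusT N ⊛ g)) l           ≡⟨ ∇-extend (powPS oneMinusT N ⊛ g) l ⟩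
  extend (∇ℕ (powPS oneMinusT N ⊛ g)) l          ≡⟨ extend-cong (∇ℕ-⊛ (powPS oneMinusT N) g) l ⟨
  extend (∇ℕ (powPS oneMinusT N) ⊛ g) l          ≡⟨ extend-cong (⊛-congˡ g (oneMinusT-⊛ (powPS oneMinusT N))) l ⟨
  extend (powPS oneMinusT (suc N) ⊛ g) l         ∎
  where open ≡-Reasoning

∇^-linear : ∀ N b f g l → ∇^ N (λ l → f l ℤ.+ b ℤ.* g l) l ≡ ∇^ N f l ℤ.+ b ℤ.* ∇^ N g l
∇^-linear zero b f g l = refl
∇^-linear (suc N) b f g l = trans (∇-cong (∇^-linear N b f g) l)
  (lemma b (∇^ N f l) (∇^ N f (ℤ.pred l)) (∇^ N g l) (∇^ N g (ℤ.pred l)))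
  where
  lemma : ∀ b p q r s → (p ℤ.+ b ℤ.* r) ℤ.- (q ℤ.+ b ℤ.* s) ≡ (p ℤ.- q) ℤ.+ b ℤ.* (r ℤ.- s)
  lemma = solve-∀

-- The reflection l ↦ -1 - l, given by cases so that it swaps the two constructors by computation.
mirror : ℤ → ℤ
mirror (+ n)    = -[1+ n ]
mirror -[1+ n ] = + n

mirror-def : ∀ l → mirror l ≡ -1ℤ ℤ.- l
mirror-def (+ zero) = refl
mirror-def (+ suc n) = refl
mirror-def -[1+ n ] = refl

mirror-involutive : ∀ l → mirror (mirror l) ≡ l
mirror-involutive (+ n) = refl
mirror-involutive -[1+ n ] = refl

-- Reflection turns a backward difference into minus a forward one, so every step contributes a sign
-- and a shift by 1.
∇^-mirror : ∀ N g l → ∇^ N (g ∘ mirror) l ≡ -1ℤ ℤ.^ N ℤ.* ∇^ N g (mirror l ℤ.+ + N)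
∇^-mirror zero g l = sym (trans (ℤₚ.*-identityˡ _) (cong g (ℤₚ.+-identityʳ (mirror l))))
∇^-mirror (suc N) g l = begin
  ∇^ N (g ∘ mirror) l ℤ.- ∇^ N (g ∘ mirror) (ℤ.pred l)
    ≡⟨ cong₂ ℤ._-_ (∇^-mirror N g l) (∇^-mirror N g (ℤ.pred l)) ⟩
  -1ℤ ℤ.^ N ℤ.* G (mirror l ℤ.+ + N) ℤ.- -1ℤ ℤ.^ N ℤ.* G (mirror (ℤ.pred l) ℤ.+ + N)
    ≡⟨ cong₂ (λ u v → -1ℤ ℤ.^ N ℤ.* G u ℤ.- -1ℤ ℤ.^ N ℤ.* G v) shift₁ shift₂ ⟩
  -1ℤ ℤ.^ N ℤ.* G (ℤ.pred (mirror l ℤ.+ + suc N)) ℤ.- -1ℤ ℤ.^ N ℤ.* G (mirror l ℤ.+ + suc N)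
    ≡⟨ lemma (-1ℤ ℤ.^ N) (G (ℤ.pred (mirror l ℤ.+ + suc N))) (G (mirror l ℤ.+ + suc N)) ⟩
  -1ℤ ℤ.^ suc N ℤ.* ∇ G (mirror l ℤ.+ + suc N)
    ∎
  where
  open ≡-Reasoning
  G = ∇^ N g
  lemma : ∀ s u v → s ℤ.* u ℤ.- s ℤ.* v ≡ (-1ℤ ℤ.* s) ℤ.* (v ℤ.- u)
  lemma = solve-∀
  lemma₁ : ∀ t n → t ℤ.+ n ≡ -1ℤ ℤ.+ (t ℤ.+ (1ℤ ℤ.+ n))
  lemma₁ = solve-∀
  shift₁ : mirror l ℤ.+ + N ≡ ℤ.pred (mirror l ℤ.+ + suc N)
  shift₁ = lemma₁ (mirror l) (+ N)
  lemma₂ : ∀ l n → -1ℤ ℤ.- (-1ℤ ℤ.+ l) ℤ.+ n ≡ -1ℤ ℤ.- l ℤ.+ (1ℤ ℤ.+ n)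
  lemma₂ = solve-∀
  shift₂ : mirror (ℤ.pred l) ℤ.+ + N ≡ mirror l ℤ.+ + suc N
  shift₂ = trans (cong (ℤ._+ + N) (mirror-def (ℤ.pred l)))
    (trans (lemma₂ l (+ N)) (cong (ℤ._+ + suc N) (sym (mirror-def l))))

-- Torsion sequences and comparison of numerators

TorsionSeq : (ℤ → ℤ) → Set
TorsionSeq = Torsion ℤ._+_ (_≢ 0ℤ)

torsion-∇^ : ∀ N {a} → TorsionSeq a → TorsionSeq (∇^ N a)
torsion-∇^ zero t = t
torsion-∇^ (suc N) {a} t = torsion-scale -1ℤ (torsion-difference comm₂ -1ℤ (torsion-∇^ N t)) λ l →
  trans (cong (λ m → ∇^ N a l ℤ.- ∇^ N a m) (ℤₚ.+-comm -1ℤ l)) (lemma (∇^ N a l) (∇^ N a (l ℤ.+ -1ℤ)))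
  where
  comm₂ : ∀ x v w → x ℤ.+ v ℤ.+ w ≡ x ℤ.+ w ℤ.+ v
  comm₂ = solve-∀
  lemma : ∀ p q → p ℤ.- q ≡ -1ℤ ℤ.* (q ℤ.- p)
  lemma = solve-∀

periodic-vanish : ∀ {a : ℤ → ℤ} e {N} → (∀ l → a (l ℤ.+ + suc e) ≡ a l) → (∀ l → N ℤ.≤ l → a l ≡ 0ℤ) → ∀ l → a l ≡ 0ℤ
periodic-vanish {a} e {N} periodic zero-above l = climb ℤ.∣ N ℤ.- l ∣ l
  (ℤₚ.≤-trans (ℤₚ.≤-reflexive (lemma N l)) (ℤₚ.+-monoʳ-≤ l (i≤+∣i∣ (N ℤ.- l))))
  where
  lemma : ∀ N l → N ≡ l ℤ.+ (N ℤ.- l)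
  lemma = solve-∀
  lemma₂ : ∀ l f → l ℤ.+ (1ℤ ℤ.+ f) ≡ l ℤ.+ 1ℤ ℤ.+ f
  lemma₂ = solve-∀
  climb : ∀ fuel l → N ℤ.≤ l ℤ.+ + fuel → a l ≡ 0ℤ
  climb zero l N≤ = zero-above l (subst (N ℤ.≤_) (ℤₚ.+-identityʳ l) N≤)
  climb (suc fuel) l N≤ = trans (sym (periodic l)) (climb fuel (l ℤ.+ + suc e)
    (ℤₚ.≤-trans N≤ (ℤₚ.≤-trans (ℤₚ.≤-reflexive (lemma₂ l (+ fuel)))
      (ℤₚ.+-monoˡ-≤ (+ fuel) (ℤₚ.+-monoʳ-≤ l (ℤ.+≤+ (s≤s z≤n)))))))

-- By induction the difference by e vanishes everywhere, so the sequence has a nonzero period, and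
-- every index reaches the range of zeros by whole periods.
torsion-vanish : ∀ {a} → TorsionSeq a → ∀ N → (∀ l → N ℤ.≤ l → a l ≡ 0ℤ) → ∀ l → a l ≡ 0ℤ
torsion-vanish (vanish a≡0) N _ = a≡0
torsion-vanish {a} (along e e≢0 t) N zero-above = invariant e e≢0 λ l →
  -- The maximum of N and N - e keeps both l and l + e above N, for either sign of e.
  ℤₚ.i-j≡0⇒i≡j _ _ (torsion-vanish t (N ℤ.⊔ (N ℤ.- e)) (λ l N≤l → cong₂ ℤ._-_
    (zero-above (l ℤ.+ e) (ℤₚ.≤-trans (ℤₚ.≤-reflexive (lemma N e)) (ℤₚ.+-monoˡ-≤ e (ℤₚ.≤-trans (ℤₚ.i≤j⊔i N (N ℤ.- e)) N≤l))))
    (zero-above l (ℤₚ.≤-trans (ℤₚ.i≤i⊔j N (N ℤ.- e)) N≤l))) l)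
  where
  lemma : ∀ N e → N ≡ N ℤ.- e ℤ.+ e
  lemma = solve-∀
  lemma₂ : ∀ l e → l ℤ.+ e ℤ.+ ℤ.- e ≡ l
  lemma₂ = solve-∀
  invariant : ∀ e → e ≢ 0ℤ → (∀ l → a (l ℤ.+ e) ≡ a l) → ∀ l → a l ≡ 0ℤ
  invariant (+ zero) e≢0 _ = ⊥-elim (e≢0 refl)
  invariant (+ suc e) _ periodic = periodic-vanish e periodic zero-above
  invariant -[1+ e ] _ periodic = periodic-vanish e
    (λ l → trans (sym (periodic (l ℤ.+ + suc e))) (cong a (lemma₂ l (+ suc e)))) zero-above

truncPS-≤ : ∀ {n i} δ → i ≤ n → truncPS n δ i ≡ δ i
truncPS-≤ {n} {i} δ i≤n with i ℕ.≤ᵇ n | ℕₚ.≤⇒≤ᵇ i≤n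
... | true | _ = refl

truncPS-> : ∀ {n i} δ → n < i → truncPS n δ i ≡ 0ℤ
truncPS-> {n} {i} δ n<i with i ℕ.≤ᵇ n in eq
... | false = refl
... | true = ⊥-elim (ℕₚ.<⇒≱ n<i (ℕₚ.≤ᵇ⇒≤ i n (subst T (sym eq) _)))

-- Applying `∇^ (suc n)` to the glued sequence gives δ at l minus δ′ at n - l, both extended by 0,
-- since the sign (-1)^{n+1} occurs twice. This is 0 for l > n, hence for all l by torsion.
numerator-duality : ∀ n (f f′ : ℕ → ℤ) δ δ′ →
  (∀ i → (powPS oneMinusT (suc n) ⊛ f) i ≡ truncPS n δ i) →
  (∀ i → (powPS oneMinusT (suc n) ⊛ f′) i ≡ truncPS n δ′ i) →
  TorsionSeq (λ l → extend f l ℤ.+ ℤ.- (-1ℤ ℤ.^ suc n) ℤ.* extend f′ (mirror l)) →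
  ∀ i → i ≤ n → δ i ≡ δ′ (n ∸ i)
numerator-duality n f f′ δ δ′ h h′ torsion i i≤n = begin
  δ i                                              ≡⟨ truncPS-≤ δ i≤n ⟨
  truncPS n δ i                                    ≡⟨ ℤₚ.i-j≡0⇒i≡j _ _ (trans (sym (glued-∇ (+ i))) (glued≡0 (+ i))) ⟩
  -- The argument is `mirror (+ i) ℤ.+ + suc n` after computation, that is n - i.
  extend (truncPS n δ′) (suc n ℤ.⊖ suc i)          ≡⟨ cong (extend (truncPS n δ′)) (trans (ℤₚ.[1+m]⊖[1+n]≡m⊖n n i) (ℤₚ.⊖-≥ i≤n)) ⟩
  truncPS n δ′ (n ∸ i)                             ≡⟨ truncPS-≤ δ′ (ℕₚ.m∸n≤m n i) ⟩
  δ′ (n ∸ i)                                       ∎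
  where
  open ≡-Reasoning
  s = -1ℤ ℤ.^ suc n
  glued : ℤ → ℤ
  glued l = extend f l ℤ.+ ℤ.- s ℤ.* extend f′ (mirror l)
  s*s : ∀ N → -1ℤ ℤ.^ N ℤ.* -1ℤ ℤ.^ N ≡ 1ℤ
  s*s zero = refl
  s*s (suc N) = trans (lemma (-1ℤ ℤ.^ N)) (s*s N)
    where
    lemma : ∀ s → (-1ℤ ℤ.* s) ℤ.* (-1ℤ ℤ.* s) ≡ s ℤ.* s
    lemma = solve-∀
  glued-∇ : ∀ l → ∇^ (suc n) glued l ≡ extend (truncPS n δ) l ℤ.- extend (truncPS n δ′) (mirror l ℤ.+ + suc n)
  glued-∇ l = begin
    ∇^ (suc n) glued l
      ≡⟨ ∇^-linear (suc n) (ℤ.- s) (extend f) (extend f′ ∘ mirror) l ⟩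
    ∇^ (suc n) (extend f) l ℤ.+ ℤ.- s ℤ.* ∇^ (suc n) (extend f′ ∘ mirror) l
      ≡⟨ cong₂ (λ u v → u ℤ.+ ℤ.- s ℤ.* v)
           (trans (∇^-extend (suc n) f l) (extend-cong h l))
           (trans (∇^-mirror (suc n) (extend f′) l) (cong (s ℤ.*_)
             (trans (∇^-extend (suc n) f′ (mirror l ℤ.+ + suc n)) (extend-cong h′ (mirror l ℤ.+ + suc n))))) ⟩
    u ℤ.+ ℤ.- s ℤ.* (s ℤ.* v)
      ≡⟨ lemma u s v ⟩
    u ℤ.- s ℤ.* s ℤ.* v
      ≡⟨ cong (λ t → u ℤ.- t) (trans (cong (ℤ._* v) (s*s (suc n))) (ℤₚ.*-identityˡ v)) ⟩
    u ℤ.- v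
      ∎
    where
    u = extend (truncPS n δ) l
    v = extend (truncPS n δ′) (mirror l ℤ.+ + suc n)
    lemma : ∀ u s v → u ℤ.+ ℤ.- s ℤ.* (s ℤ.* v) ≡ u ℤ.- s ℤ.* s ℤ.* v
    lemma = solve-∀
  above : ∀ l → + suc n ℤ.≤ l → ∇^ (suc n) glued l ≡ 0ℤ
  above (+ j) (ℤ.+≤+ n<j) = trans (glued-∇ (+ j)) (cong₂ ℤ._-_ (truncPS-> δ n<j)
    (cong (extend (truncPS n δ′)) (trans (ℤₚ.[1+m]⊖[1+n]≡m⊖n n j) (trans (ℤₚ.⊖-< n<j) (negative (ℕₚ.m<n⇒0<n∸m n<j))))))
    where
    negative : ∀ {t} → 0 < t → ℤ.- + t ≡ -[1+ ℕ.pred t ]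
    negative {suc t} _ = refl
  glued≡0 : ∀ l → ∇^ (suc n) glued l ≡ 0ℤ
  glued≡0 = torsion-vanish (torsion-∇^ (suc n) torsion) (+ suc n) above

-- Reciprocity for the lattice point count

∙-⊖ : ∀ {d} (a x : Vec ℤ d) → a ∙ ⊖ x ≡ ℤ.- (a ∙ x)
∙-⊖ [] [] = refl
∙-⊖ (a ∷ as) (x ∷ xs) rewrite ∙-⊖ as xs = lemma a x (as ∙ xs)
  where
  lemma : ∀ a x p → a ℤ.* ℤ.- x ℤ.+ ℤ.- p ≡ ℤ.- (a ℤ.* x ℤ.+ p)
  lemma = solve-∀

⊖-involutive : ∀ {d} (x : Vec ℤ d) → ⊖ ⊖ x ≡ x
⊖-involutive [] = refl
⊖-involutive (x ∷ xs) = cong₂ _∷_ (ℤₚ.neg-involutive x) (⊖-involutive xs)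

-- The cone over the polytope, with the height m as first coordinate: m - u · x ≥ 0.
coneLiterals : ∀ {n p} → Vec (Vec ℤ n) p → Literals (suc n)
coneLiterals [] = []
coneLiterals (u ∷ us) = (true , 1ℤ ∷ ⊖ u) ∷ coneLiterals us

cone-functional : ∀ {n} (u x : Vec ℤ n) m → (1ℤ ∷ ⊖ u) ∙ (m ∷ x) ≡ m ℤ.- u ∙ x
cone-functional u x m = cong₂ ℤ._+_ (ℤₚ.*-identityˡ m)
  (trans (∙-comm (⊖ u) x) (trans (∙-⊖ x u) (cong ℤ.-_ (∙-comm x u))))

coneLiterals-positive : ∀ {n p} (us : Vec (Vec ℤ n) p) → PositiveAt (1ℤ ∷ 0ᵥ) (coneLiterals us)
coneLiterals-positive [] = ListAll.[]
coneLiterals-positive (u ∷ us) = subst (0ℤ ℤ.<_)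
  (sym (trans (cone-functional u 0ᵥ 1ℤ) (cong (λ t → 1ℤ ℤ.- t) (∙-zeroʳ u)))) (ℤ.+<+ (s≤s z≤n)) ListAll.∷ coneLiterals-positive us

literal≡1 : ∀ t → 0ℤ ℤ.≤ t → literal true t ≡ 1ℤ
literal≡1 (+ _) _ = refl

literal≢0 : ∀ t {q} → literal true t ℤ.* q ≢ 0ℤ → 0ℤ ℤ.≤ t × q ≢ 0ℤ
literal≢0 (+ _) ≢0 = ℤ.+≤+ z≤n , λ { refl → ≢0 refl }
literal≢0 -[1+ _ ] ≢0 = ⊥-elim (≢0 refl)

cone-inside : ∀ {n p} (us : Vec (Vec ℤ n) p) m x → All (λ u → u ∙ x ℤ.≤ m) us → ⟦ coneLiterals us ⟧ (m ∷ x) ≡ 1ℤ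
cone-inside [] m x [] = refl
cone-inside (u ∷ us) m x (p ∷ ps) = cong₂ ℤ._*_
  (literal≡1 _ (subst (0ℤ ℤ.≤_) (sym (cone-functional u x m)) (ℤₚ.i≤j⇒0≤j-i p))) (cone-inside us m x ps)

cone-support : ∀ {n p} (us : Vec (Vec ℤ n) p) m x → ⟦ coneLiterals us ⟧ (m ∷ x) ≢ 0ℤ → All (λ u → u ∙ x ℤ.≤ m) us
cone-support [] m x _ = []
cone-support (u ∷ us) m x ≢0 with literal≢0 ((1ℤ ∷ ⊖ u) ∙ (m ∷ x)) ≢0
... | p , q = ℤₚ.0≤i-j⇒j≤i (subst (0ℤ ℤ.≤_) (cone-functional u x m) p) ∷ cone-support us m x q

literal-mirror : ∀ t → literal false t ≡ literal true (mirror t)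
literal-mirror (+ _) = refl
literal-mirror -[1+ _ ] = refl

-- u · x > m iff u · (- x) ≤ - 1 - m: the interior of the cone at height m + 1 is the cone at height m.
cone-mirror : ∀ {n p} (us : Vec (Vec ℤ n) p) m x →
  ⟦ negate (coneLiterals us) ⟧ (m ∷ x) ≡ ⟦ coneLiterals us ⟧ (mirror m ∷ ⊖ x)
cone-mirror [] m x = refl
cone-mirror (u ∷ us) m x = cong₂ ℤ._*_ (trans (literal-mirror ((1ℤ ∷ ⊖ u) ∙ (m ∷ x))) (cong (literal true) (begin
  mirror ((1ℤ ∷ ⊖ u) ∙ (m ∷ x))         ≡⟨ cong mirror (cone-functional u x m) ⟩
  mirror (m ℤ.- u ∙ x)                  ≡⟨ mirror-def (m ℤ.- u ∙ x) ⟩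
  -1ℤ ℤ.- (m ℤ.- u ∙ x)                 ≡⟨ lemma m (u ∙ x) ⟩
  -1ℤ ℤ.- m ℤ.- ℤ.- (u ∙ x)             ≡⟨ cong₂ ℤ._-_ (mirror-def m) (∙-⊖ u x) ⟨
  mirror m ℤ.- u ∙ ⊖ x                  ≡⟨ cone-functional u (⊖ x) (mirror m) ⟨
  (1ℤ ∷ ⊖ u) ∙ (mirror m ∷ ⊖ x)         ∎))) (cone-mirror us m x)
  where
  open ≡-Reasoning
  lemma : ∀ m t → -1ℤ ℤ.- (m ℤ.- t) ≡ -1ℤ ℤ.- m ℤ.- ℤ.- t
  lemma = solve-∀

-- The source of the pairing of residues: -1 - (lk + r) = (-1 - l)k + (k - 1 - r).
mirror-progression : ∀ k r → r < k → ∀ l → mirror (l ℤ.* + k ℤ.+ + r) ≡ mirror l ℤ.* + k ℤ.+ + (k ∸ r ∸ 1)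
mirror-progression k r r<k l = begin
  mirror (l ℤ.* + k ℤ.+ + r)                            ≡⟨ mirror-def (l ℤ.* + k ℤ.+ + r) ⟩
  -1ℤ ℤ.- (l ℤ.* + k ℤ.+ + r)                           ≡⟨ lemma l (+ k) (+ r) ⟩
  (-1ℤ ℤ.- l) ℤ.* + k ℤ.+ (+ k ℤ.- (1ℤ ℤ.+ + r))        ≡⟨ cong₂ (λ t s → t ℤ.* + k ℤ.+ s) (sym (mirror-def l)) residue ⟩
  mirror l ℤ.* + k ℤ.+ + (k ∸ r ∸ 1)                    ∎
  where
  open ≡-Reasoning
  lemma : ∀ l k r → -1ℤ ℤ.- (l ℤ.* k ℤ.+ r) ≡ (-1ℤ ℤ.- l) ℤ.* k ℤ.+ (k ℤ.- (1ℤ ℤ.+ r))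
  lemma = solve-∀
  residue : + k ℤ.- + suc r ≡ + (k ∸ r ∸ 1)
  residue = trans (ℤₚ.m-n≡m⊖n k (suc r)) (trans (ℤₚ.⊖-≥ r<k)
    (cong +_ (trans (cong (k ∸_) (ℕₚ.+-comm 1 r)) (sym (ℕₚ.∸-+-assoc k r 1)))))

progression : ∀ n k r → + n ℤ.* + k ℤ.+ + r ≡ + (n ℕ.* k ℕ.+ r)
progression n k r = cong (ℤ._+ + r) (sym (ℤₚ.pos-* n k))

-- Because 0 ≤ r < k, the index lk + r is negative exactly when l is.
extend-progression : ∀ (g : ℕ → ℤ) k r → r < k → ∀ l →
  extend g (l ℤ.* + k ℤ.+ + r) ≡ extend (λ n → g (n ℕ.* k ℕ.+ r)) l
extend-progression g k r r<k (+ n) = cong (extend g) (progression n k r)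
extend-progression g k r r<k -[1+ n ] = cong (extend g) (begin
  -[1+ n ] ℤ.* + k ℤ.+ + r                            ≡⟨ mirror-involutive _ ⟨
  mirror (mirror (-[1+ n ] ℤ.* + k ℤ.+ + r))          ≡⟨ cong mirror (mirror-progression k r r<k -[1+ n ]) ⟩
  mirror (+ n ℤ.* + k ℤ.+ + (k ∸ r ∸ 1))              ≡⟨ cong mirror (progression n k (k ∸ r ∸ 1)) ⟩
  -[1+ n ℕ.* k ℕ.+ (k ∸ r ∸ 1) ]                      ∎)
  where open ≡-Reasoning

module _ {n m p} (vs : Vec (Point n) m) (ws : Vec (IntPoint n) p) (c : ℕ → ℕ)
  (0∈P : InConv vs origin)
  (dual⊆ : ∀ u → InDual vs u → InConv (map intPt ws) u)
  (⊆dual : ∀ u → InConv (map intPt ws) u → InDual vs u)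
  (ehrhart : IsEhrhart vs c) where

  private
    S : Literals (suc n)
    S = coneLiterals ws
    count : ℤ → ℤ
    count = extend (λ j → + c j)

  -- The origin lies in the dual, so it is a convex combination of `ws`; the inequalities would give
  -- 0 ≤ -1 - j.
  no-negative-dilate : ∀ j z → ¬ All (λ u → u ∙ z ℤ.≤ -[1+ j ]) ws
  no-negative-dilate j z ineqs = ℤₚ.<⇒≱ {(-[1+ j ])} {0ℤ} ℤ.-<+ (toℚ-cancel-≤
    (subst (ℚ._≤ toℚ -[1+ j ]) (⟨,⟩-origin (intPt z))
      (convex-bound (intPt z) (toℚ -[1+ j ])
        (Allₚ.map⁺ (All.map (λ {u} u·z≤ → subst (ℚ._≤ toℚ -[1+ j ])
          (trans (sym (⟨,⟩-intPt u z)) (⟨,⟩-comm (intPt u) (intPt z))) (toℚ-mono-≤ u·z≤)) ineqs))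
        (dual⊆ origin λ v _ → subst (ℚ._≤ 1ℚ) (sym (trans (⟨,⟩-comm origin v) (⟨,⟩-origin v))) (ℚₚ.nonNegative⁻¹ 1ℚ)))))

  -- At height h ≥ 0 the cone product is the indicator of the lattice points of hP; below height 0
  -- the fibre is empty.
  fibre-count : ∀ h → IsSum (λ x → ⟦ S ⟧ (h ∷ x)) (count h)
  fibre-count -[1+ j ] = [] , AllPairs.[] , (λ x ≢0 → ⊥-elim (no-negative-dilate j x (cone-support ws -[1+ j ] x ≢0))) , refl
  fibre-count (+ j) with ehrhart j
  ... | zs , length≡ , unique , sound , complete =
    zs , unique ,
    (λ x ≢0 → complete x (inequalities⇒dilate vs ws 0∈P dual⊆ ⊆dual j x (cone-support ws (+ j) x ≢0))) ,
    trans (sum-ones zs λ z z∈ → cone-inside ws (+ j) z (dilate⇒inequalities vs ws 0∈P dual⊆ ⊆dual j z (sound z z∈))) (cong +_ length≡)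
    where
    sum-ones : ∀ {g : Vec ℤ n → ℤ} zs → (∀ z → z ∈ zs → g z ≡ 1ℤ) → sumOver g zs ≡ + length zs
    sum-ones [] _ = refl
    sum-ones (z ∷ zs) g≡1 = cong₂ ℤ._+_ (g≡1 z (here refl)) (sum-ones zs λ z z∈ → g≡1 z (there z∈))

  fibre-count-negate : ∀ h → IsSum (λ x → ⟦ negate S ⟧ (h ∷ x)) (count (mirror h))
  fibre-count-negate h = isSum-reindex ⊖_ ⊖_ ⊖-involutive ⊖-involutive (fibre-count (mirror h)) (cone-mirror ws h)

  -- Reciprocity for the cone literals, summed over the fibres at heights lk + r. The negated
  -- product counts the reflected heights, which lie in the residue class k - r - 1.
  reciprocity : ∀ k r → r < k → TorsionSeq (λ l →
    extend (λ l → + c (l ℕ.* k ℕ.+ r)) l ℤ.+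
    ℤ.- (-1ℤ ℤ.^ suc n) ℤ.* extend (λ l → + c (l ℕ.* k ℕ.+ (k ∸ r ∸ 1))) (mirror l))
  reciprocity k r r<k = fibre-sum-torsion (+ r) (drop-horizontal k≢0 fibreFinite torsion) λ l →
    subst (IsSum _) (cong₂ (λ s t → s ℤ.+ ℤ.- (-1ℤ ℤ.^ suc n) ℤ.* t)
        (extend-progression (λ j → + c j) k r r<k l)
        (trans (cong count (mirror-progression k r r<k l))
               (extend-progression (λ j → + c j) k (k ∸ r ∸ 1) r′<k (mirror l))))
      (fibre-sum (l ℤ.* + k ℤ.+ + r))
    where
    k≢0 : + k ≢ 0ℤ
    k≢0 refl = ℕₚ.n≮0 r<k
    r′<k : k ∸ r ∸ 1 < k
    r′<k = ℕₚ.≤-<-trans (ℕₚ.≤-reflexive (ℕₚ.∸-+-assoc k r 1))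
      (ℕₚ.∸-monoʳ-< {k} {r ℕ.+ 1} {0} (subst (0 <_) (ℕₚ.+-comm 1 r) (s≤s z≤n)) (subst (_≤ k) (ℕₚ.+-comm 1 r) r<k))
    f : Vec ℤ (suc n) → ℤ
    f z = ⟦ S ⟧ z ℤ.- -1ℤ ℤ.^ suc n ℤ.* ⟦ negate S ⟧ z
    torsion : TorsionVec (+ k) k≢0 n f
    torsion = reciprocal (+ k) k≢0 n (1ℤ ∷ 0ᵥ) S (coneLiterals-positive ws)
    fibre-sum : ∀ h → IsSum (λ x → f (h ∷ x)) (count h ℤ.+ ℤ.- (-1ℤ ℤ.^ suc n) ℤ.* count (mirror h))
    fibre-sum h = isSum-linear (≡-dec ℤ._≟_) (ℤ.- (-1ℤ ℤ.^ suc n)) (fibre-count h) (fibre-count-negate h)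
      λ x → cong (λ t → ⟦ S ⟧ (h ∷ x) ℤ.+ t) (ℤₚ.neg-distribˡ-* (-1ℤ ℤ.^ suc n) (⟦ negate S ⟧ (h ∷ x)))
    fibreFinite : FibreFinite f
    fibreFinite h = let (xs , _ , covers , _) = fibre-sum h in xs , covers

theorem2p1 : (n m : ℕ) (vs : Vec (Point n) m) (k : ℕ) (c : ℕ → ℕ) →
    FullDim vs → InConv vs origin → IsLatticePolytopeSet (InDual vs) →
    IsMinDenominator vs k → IsEhrhart vs c →
    (r : ℕ) → r < k → (δ δ′ : ℕ → ℤ) →
    IsHStar n k c r δ → IsHStar n k c (k ∸ r ∸ 1) δ′ →
    (i : ℕ) → i ≤ n → δ i ≡ δ′ (n ∸ i)
theorem2p1 n m vs k c _ 0∈P (p , ws , dual⊆ , ⊆dual) _ ehrhart r r<k δ δ′ h h′ =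
  numerator-duality n _ _ δ δ′ h h′ (reciprocity vs ws c 0∈P dual⊆ ⊆dual ehrhart k r r<k)
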